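{- Let $p$ be a binary word with $r$ runs, minimum run length $r_{\min}$, and maximum run length $r_{\max}$. Let $w$ be a binary word and let $w'$ be $w$ with all negligible boundary runs with respect to $p$ removed. Let $R'$ and $R'_{\max}$ be the number of runs and the maximum run length of $w'$, respectively. For each $1\le i\le r$, set $$\sigma_{r,R'}(i)=\begin{cases}\mathcal{O}_{\le}(R'/r)+2 & \text{if } i\le \tfrac12\,\mathcal{E}_{\le}\bigl(R'-r\,\mathcal{O}_{\le}(R'/r)\bigr),\\ \mathcal{O}_{\le}(R'/r) & \text{otherwise.}\end{cases}$$ Then $$c_p(w)\le \binom{\left\lfloor\frac{R'-r}{2}\right\rfloor+r}{r}\prod_{i=1}^{r}R'_{\max}\left(\frac{R'_{\max}}{2}\bigl(\sigma_{r,R'}(i)+1\bigr)-r_{\min}+1\right)^{r_{\max}-1},$$ with equality when $p$ and $w$ are alternating.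
   Context: A binary word of length $n$ is a string $w=w_1\cdots w_n\in\{0,1\}^n$. An occurrence of $p=p_1\cdots p_\ell$ in $w=w_1\cdots w_n$ is a choice of indices $1\le i_1<\cdots<i_\ell\le n$ such that $w_{i_1}\cdots w_{i_\ell}=p$; $c_p(w)$ is the number of occurrences of $p$ in $w$. A run of length $L$ in a binary word is a maximal block of $L$ consecutive equal letters. A negligible boundary run (NBR) of $w=w_1\cdots w_n$ with respect to $p=p_1\cdots p_\ell$ is either (i) the run at the beginning of $w$, if $w_1\ne p_1$, or (ii) the run at the end of $w$, if $w_n\ne p_\ell$. A binary word is alternating if all its runs have length $1$. For real $x$, $\mathcal{O}_{\le}(x)$ is the largest odd integer $\le x$ and $\mathcal{E}_{\le}(x)$ is the largest even integer $\le x$.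
   Formalization: The inequality is proved as c_p(w) ≤ max(0, B), B being the stated right-hand side, since B can be negative: p = 1111, w = 11 gives c_p(w) = 0 but B = −2. Whenever B ≥ 0 this is the stated bound; the equality for alternating words is with B itself. -}

module Defs where

open import Data.Bool using (Bool; if_then_else_)
open import Data.Bool.Properties using () renaming (_≟_ to _≟ᴮ_)
open import Data.Fin using (Fin; toℕ) renaming (_<_ to _<ᶠ_)
open import Data.Fin.Properties using (_<?_)
open import Data.Integer as ℤ using (ℤ; +_; -[1+_])
import Data.Integer.DivMod as ℤ
import Data.Integer.Properties as ℤ
open import Data.List using (List; []; _∷_; length; map; concat; filter; reverse; lookup; allFin; cartesianProductWith)
open import Data.List.Extrema.Nat using (min; max)
open import Data.List.NonEmpty as List⁺ using (List⁺; groupSeqs)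
open import Data.List.Properties using (≡-dec)
open import Data.List.Relation.Unary.All using (All)
open import Data.List.Relation.Unary.Linked using (Linked; linked?)
open import Data.Nat as ℕ using (ℕ; zero; suc; _∸_)
open import Data.Nat.Combinatorics using (_C_)
open import Data.Product using (∃; _×_; _,_)
open import Data.Rational as ℚ using (ℚ; 1ℚ; ½; floor)
open import Data.Rational.Literals using (fromℤ)
import Data.Rational.Properties as ℚ
open import Data.Sum using (reduce; inj₁; inj₂)
open import Function using (_∘_)
open import Relation.Binary.PropositionalEquality using (_≡_; refl; sym; subst)
open import Relation.Nullary using (does; ¬?; _×-dec_)
open import Relation.Unary using (Pred; Decidable)

open import Algebra.Definitions.RawSemiring ℚ.+-*-rawSemiring using (_^_; product)

Letter : Set
Letter = Bool

Word : Set
Word = List Letter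

-- The list is the index sequence i₁ < ⋯ < i_ℓ; adjacent comparisons
-- suffice for it to be strictly increasing, and its length is forced
-- to be that of p by the second component.
IsOccurrence : (p w : Word) → List (Fin (length w)) → Set
IsOccurrence p w is = Linked _<ᶠ_ is × map (lookup w) is ≡ p

isOccurrence? : (p w : Word) → Decidable (IsOccurrence p w)
isOccurrence? p w is =
  linked? _<?_ is ×-dec ≡-dec _≟ᴮ_ (map (lookup w) is) p

-- All sequences in Fin n of length ℓ, each listed exactly once.
sequences : (ℓ n : ℕ) → List (List (Fin n))
sequences zero    n = [] ∷ []
sequences (suc ℓ) n = cartesianProductWith _∷_ (allFin n) (sequences ℓ n)

occurrences : (p w : Word) → ℕ
occurrences p w =
  length (filter (isOccurrence? p w) (sequences (length p) (length w)))

-- groupSeqs splits a list into its maximal blocks on which the test is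
-- constant, tagging each block by the outcome; the tag is forgotten.
runs : Word → List (List⁺ Letter)
runs = map reduce ∘ groupSeqs (_≟ᴮ Bool.true)

numRuns : Word → ℕ
numRuns = length ∘ runs

runLengths : Word → List ℕ
runLengths = map List⁺.length ∘ runs

maxRun : Word → ℕ
maxRun w = max 0 (runLengths w)

-- The first argument of min is only a starting value: no run of w is
-- longer than w, so for nonempty w this is the least run length.
minRun : Word → ℕ
minRun w = min (length w) (runLengths w)

Alternating : Word → Set
Alternating w = All (_≡ 1) (runLengths w)

numRuns-nonZero : (p : List⁺ Letter) → ℕ.NonZero (numRuns (List⁺.toList p))
numRuns-nonZero (x List⁺.∷ xs) with does (x ≟ᴮ Bool.true) | groupSeqs (_≟ᴮ Bool.true) xs
... | Bool.true  | []         = _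
... | Bool.true  | inj₁ _ ∷ _ = _
... | Bool.true  | inj₂ _ ∷ _ = _
... | Bool.false | []         = _
... | Bool.false | inj₁ _ ∷ _ = _
... | Bool.false | inj₂ _ ∷ _ = _

module _ {a ℓ} {A : Set a} {P : Pred A ℓ} (P? : Decidable P) where

  dropFirstIf : List A → List A
  dropFirstIf []       = []
  dropFirstIf (x ∷ xs) = if does (P? x) then xs else x ∷ xs

  dropLastIf : List A → List A
  dropLastIf = reverse ∘ dropFirstIf ∘ reverse

-- Removing the two boundary runs one after the other agrees with
-- removing them simultaneously: if the first removal leaves anything,
-- it leaves the final run of w in place.
removeNBRs : List⁺ Letter → Word → Word
removeNBRs p w =
  concat (map List⁺.toList
    (dropLastIf  (λ u → ¬? (List⁺.last u ≟ᴮ List⁺.last p))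
    (dropFirstIf (λ u → ¬? (List⁺.head u ≟ᴮ List⁺.head p))
    (runs w))))

Odd Even : ℤ → Set
Odd  m = ∃ λ k → m ≡ + 2 ℤ.* k ℤ.+ + 1
Even m = ∃ λ k → m ≡ + 2 ℤ.* k

O≤ : ℚ → ℤ
O≤ x = + 2 ℤ.* ((floor x ℤ.- + 1) ℤ./ + 2) ℤ.+ + 1

E≤ : ℚ → ℤ
E≤ x = + 2 ℤ.* (floor x ℤ./ + 2)

IsLargestBelow : (ℤ → Set) → ℚ → ℤ → Set
IsLargestBelow P x m =
  P m × fromℤ m ℚ.≤ x × (∀ n → P n → fromℤ n ℚ.≤ x → n ℤ.≤ m)

private
  ≤/⇒*≤ : ∀ {k} n d .{{_ : ℕ.NonZero d}} → k ℤ.≤ n ℤ./ + d → k ℤ.* + d ℤ.≤ n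
  ≤/⇒*≤ n d@(suc _) k≤ =
    ℤ.≤-trans (ℤ.*-monoʳ-≤-nonNeg (+ d) k≤) (ℤ.[n/d]*d≤n n (+ d))

  *≤⇒≤/ : ∀ {k} n d .{{_ : ℕ.NonZero d}} → k ℤ.* + d ℤ.≤ n → k ℤ.≤ n ℤ./ + d
  *≤⇒≤/ {k} n d@(suc _) k*d≤n =
    subst (k ℤ.≤_) (sym (ℤ.div-pos-is-/ℕ n d))
      (subst (k ℤ.≤_) (ℤ.pred-suc (n ℤ./ℕ d)) (ℤ.i<j⇒i≤pred[j]
        (ℤ.*-cancelʳ-<-nonNeg {k} {ℤ.suc (n ℤ./ℕ d)} (+ d) (ℤ.≤-<-trans k*d≤n (ℤ.n<s[n/ℕd]*d n d)))))

  ≤floor⇒≤ : ∀ {k} x → k ℤ.≤ floor x → fromℤ k ℚ.≤ x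
  ≤floor⇒≤ {k} x@record{} k≤ =
    ℚ.*≤* (subst (k ℤ.* ℚ.↧ x ℤ.≤_) (sym (ℤ.*-identityʳ (ℚ.↥ x))) (≤/⇒*≤ (ℚ.↥ x) (ℚ.↧ₙ x) k≤))

  ≤⇒≤floor : ∀ {k} x → fromℤ k ℚ.≤ x → k ℤ.≤ floor x
  ≤⇒≤floor {k} x@record{} (ℚ.*≤* k≤) =
    *≤⇒≤/ (ℚ.↥ x) (ℚ.↧ₙ x) (subst (k ℤ.* ℚ.↧ x ℤ.≤_) (ℤ.*-identityʳ (ℚ.↥ x)) k≤)

  2*[n/2]≤n : ∀ n → + 2 ℤ.* (n ℤ./ + 2) ℤ.≤ n
  2*[n/2]≤n n = subst (ℤ._≤ n) (ℤ.*-comm (n ℤ./ + 2) (+ 2)) (ℤ.[n/d]*d≤n n (+ 2))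

  2*k≤n⇒2*k≤2*[n/2] : ∀ k n → + 2 ℤ.* k ℤ.≤ n → + 2 ℤ.* k ℤ.≤ + 2 ℤ.* (n ℤ./ + 2)
  2*k≤n⇒2*k≤2*[n/2] k n 2k≤n =
    ℤ.*-monoˡ-≤-nonNeg (+ 2) (*≤⇒≤/ n 2 (subst (ℤ._≤ n) (ℤ.*-comm (+ 2) k) 2k≤n))

  n-1+1≡n : ∀ n → n ℤ.- + 1 ℤ.+ + 1 ≡ n
  n-1+1≡n n rewrite ℤ.+-assoc n -[1+ 0 ] (+ 1) = ℤ.+-identityʳ n

  n+1-1≡n : ∀ n → n ℤ.+ + 1 ℤ.- + 1 ≡ n
  n+1-1≡n n rewrite ℤ.+-assoc n (+ 1) -[1+ 0 ] = ℤ.+-identityʳ n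

E≤-isLargest : ∀ x → IsLargestBelow Even x (E≤ x)
E≤-isLargest x =
    (floor x ℤ./ + 2 , refl)
  , ≤floor⇒≤ x (2*[n/2]≤n (floor x))
  , λ { _ (k , refl) k≤x → 2*k≤n⇒2*k≤2*[n/2] k (floor x) (≤⇒≤floor x k≤x) }

O≤-isLargest : ∀ x → IsLargestBelow Odd x (O≤ x)
O≤-isLargest x =
    ((f ℤ.- + 1) ℤ./ + 2 , refl)
  , ≤floor⇒≤ x (subst (O≤ x ℤ.≤_) (n-1+1≡n f)
      (ℤ.+-monoˡ-≤ (+ 1) (2*[n/2]≤n (f ℤ.- + 1))))
  , λ { _ (k , refl) k≤x →
        ℤ.+-monoˡ-≤ (+ 1) (2*k≤n⇒2*k≤2*[n/2] k (f ℤ.- + 1)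
          (subst (ℤ._≤ f ℤ.- + 1) (n+1-1≡n (+ 2 ℤ.* k))
            (ℤ.+-monoˡ-≤ (ℤ.- + 1) (≤⇒≤floor x k≤x)))) }
  where f = floor x

fromℕ : ℕ → ℚ
fromℕ n = fromℤ (+ n)

-- The index i starts from 1.
σ : (r R′ : ℕ) .{{_ : ℕ.NonZero r}} → ℕ → ℤ
σ r R′ i =
  if does (fromℕ i ℚ.≤? ½ ℚ.* fromℤ (E≤ (fromℤ (+ R′ ℤ.- + r ℤ.* o))))
  then o ℤ.+ + 2
  else o
  where o = O≤ (+ R′ ℚ./ r)

-- Binomial coefficient with integer upper index.  Below it is only used
-- at ⌊(R′ − r)/2⌋ + r = ⌊(R′ + r)/2⌋ ≥ 0, so the second clause is
-- never reached.
binom : ℤ → ℕ → ℕ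
binom (+ n)    k = n C k
binom -[1+ _ ] k = 0

bound : (r rmin rmax R′ R′max : ℕ) .{{_ : ℕ.NonZero r}} → ℚ
bound r rmin rmax R′ R′max =
  fromℕ (binom (floor ((+ R′ ℤ.- + r) ℚ./ 2) ℤ.+ + r) r)
  ℚ.* product {r} (λ j →
        fromℕ R′max
        ℚ.* ( (+ R′max ℚ./ 2) ℚ.* (fromℤ (σ r R′ (suc (toℕ j))) ℚ.+ 1ℚ)
              ℚ.- fromℕ rmin ℚ.+ 1ℚ )
            ^ (rmax ∸ 1))

-- The bound for the pattern p and the word w.  When w′ is empty its
-- maximum run length is taken to be 0; the binomial coefficient
-- vanishes in that case.
patternBound : List⁺ Letter → Word → ℚ
patternBound p w =
  bound (numRuns p′) (minRun p′) (maxRun p′) (numRuns w′) (maxRun w′)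
    {{numRuns-nonZero p}}
  where
  p′ = List⁺.toList p
  w′ = removeNBRs p w

{-# OPTIONS --safe #-}
module Submission where

-- Removing the negligible boundary runs does not change the number of
-- occurrences, so w may be assumed to begin and end like p.  It then has
-- R′ = 2 s + r runs, or fewer than r and no occurrence of p.  In an occurrence,
-- let 2 tᵢ + 1 be the number of runs of w by which the last letter of the i-th
-- run of p lies beyond that of the (i − 1)-st; then t₁ + ⋯ + tᵣ ≤ s.  Write M
-- for R′max.  Given the profile (t₁, …, tᵣ) and the earlier runs, an i-th run of
-- length k + 1 has at most M places for its last letter and M (tᵢ + 1) − 1 for
-- the k others, which leaves at most
--   M · C(M (tᵢ + 1) − 1, k) ≤ M · g(tᵢ)^(rmax − 1),  g t = M (t + 1) − rmin + 1,
-- choices.  There are C(s + r, r) profiles, and since g is log-concave the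
-- product of the g(tᵢ) is largest when s = q r + m is split into m parts q + 1
-- and r − m parts q; these are the values with σ(i) = 2 tᵢ + 1.  If g(q) ≤ 0,
-- then every profile contains a part that admits no choice at all.  For
-- alternating words the count satisfies Pascal's recursion.

-- The maximum with 0 in the statement is essential: for `p` = 0000 and `w` = 0 there is no
-- occurrence, while the bound evaluates to (-2)^3 = -8. Profiles are not compared one at a time.
-- Put A = g(q)^(rmax - 1) and B = g(q + 1)^(rmax - 1), with g truncated at 0. By log-concavity
-- g(t)^(rmax - 1) lies below the geometric sequence A (B/A)^(t - q), which meets it at q and q + 1.
-- A product of these majorants depends only on t₁ + ⋯ + tᵣ, so the sum over profiles turns into a
-- count of profiles, obtained by Pascal's rule one convolution at a time. Sums below s are covered
-- because B ≥ A. Everything is cross-multiplied in ℕ. The final division by a power of A needs g(q)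
-- > 0, which forces the separate case g(q) ≤ 0. The base g comes from C(n, k) ≤ (n + 1 - k)^k with
-- n = M (t + 1) - 1 and k + 1 ≥ rmin.

-- Counting occurrences by recursion on the word

module Occurrences where

  open import Defs using (Word; IsOccurrence; isOccurrence?; sequences; occurrences)
  open import Data.Bool using (Bool; true; false; if_then_else_)
  open import Data.Bool.Properties using () renaming (_≟_ to _≟ᴮ_)
  open import Data.Fin using (Fin; zero; suc)
  open import Data.List using (List; []; _∷_; _++_; map; length; filter; allFin; cartesianProductWith; lookup)
  open import Data.List.Properties using (length-++; filter-++; map-cong; map-∘; map-tabulate; ∷-injectiveʳ; ∷-injectiveˡ)
  open import Data.List.Relation.Unary.Linked using (Linked; []; [-]; _∷_; tail)
  open import Data.Nat using (ℕ; zero; suc; _+_; z≤n; s≤s; s≤s⁻¹)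
  open import Data.Nat.ListAction using (sum)
  open import Data.Product using (_,_)
  open import Level using (0ℓ)
  open import Function using (_∘_; _⇔_; mk⇔; Equivalence)
  open import Relation.Binary.PropositionalEquality
  open import Relation.Nullary using (¬_; Dec; yes; no; does; contradiction)
  open import Relation.Nullary.Decidable using (dec-false)
  open import Relation.Unary using (Pred; Decidable)

  -- Replaces the enumeration of index sequences by a recursion on the word, which later inductions
  -- can follow.
  count : Word → Word → ℕ
  count []      w       = 1
  count (a ∷ p) []      = 0
  count (a ∷ p) (b ∷ w) = (if does (b ≟ᴮ a) then count p w else 0) + count (a ∷ p) w

  module _ {A : Set} where

    length-filter-⇔ : {P Q : Pred A 0ℓ} (P? : Decidable P) (Q? : Decidable Q) →
      (∀ x → P x ⇔ Q x) → ∀ xs → length (filter P? xs) ≡ length (filter Q? xs)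
    length-filter-⇔ P? Q? P⇔Q []       = refl
    length-filter-⇔ P? Q? P⇔Q (x ∷ xs) with P? x | Q? x
    ... | yes _ | yes _ = cong suc (length-filter-⇔ P? Q? P⇔Q xs)
    ... | no  _ | no  _ = length-filter-⇔ P? Q? P⇔Q xs
    ... | yes p | no ¬q = contradiction (Equivalence.to (P⇔Q x) p) ¬q
    ... | no ¬p | yes q = contradiction (Equivalence.from (P⇔Q x) q) ¬p

    length-filter-∅ : {P : Pred A 0ℓ} (P? : Decidable P) →
      (∀ x → ¬ P x) → ∀ xs → length (filter P? xs) ≡ 0
    length-filter-∅ P? ¬P []       = refl
    length-filter-∅ P? ¬P (x ∷ xs) rewrite dec-false (P? x) (¬P x) = length-filter-∅ P? ¬P xs

    length-filter-map : {B : Set} {P : Pred A 0ℓ} (P? : Decidable P) (f : B → A) →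
      ∀ xs → length (filter P? (map f xs)) ≡ length (filter (P? ∘ f) xs)
    length-filter-map P? f []       = refl
    length-filter-map P? f (x ∷ xs) with does (P? (f x))
    ... | true  = cong suc (length-filter-map P? f xs)
    ... | false = length-filter-map P? f xs

  length-filter-∷ : {A : Set} {P : Pred (List A) 0ℓ} (P? : Decidable P) (xs : List A) (yss : List (List A)) →
    length (filter P? (cartesianProductWith _∷_ xs yss)) ≡
    sum (map (λ x → length (filter (P? ∘ (x ∷_)) yss)) xs)
  length-filter-∷ P? []       yss = refl
  length-filter-∷ P? (x ∷ xs) yss
    rewrite filter-++ P? (map (x ∷_) yss) (cartesianProductWith _∷_ xs yss)
          | length-++ (filter P? (map (x ∷_) yss)) {filter P? (cartesianProductWith _∷_ xs yss)}
    = cong₂ _+_ (length-filter-map P? (x ∷_) yss) (length-filter-∷ P? xs yss)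

  sum-allFin : ∀ n (f : Fin (suc n) → ℕ) →
    sum (map f (allFin (suc n))) ≡ f zero + sum (map (f ∘ suc) (allFin n))
  sum-allFin n f = cong (λ xs → f zero + sum xs)
    (trans (map-tabulate suc f) (sym (map-tabulate (λ i → i) (f ∘ suc))))

  -- These are exactly the lists outside the image of `map suc`.
  data HasZero {n : ℕ} : List (Fin (suc n)) → Set where
    here  : ∀ {is} → HasZero (zero ∷ is)
    there : ∀ {i is} → HasZero is → HasZero (i ∷ is)

  -- The lists without `zero` are the images under `map suc`, each hit once. The predicate is
  -- arbitrary so that the induction on the length can absorb the first index into it.
  sequences-suc : ∀ ℓ {n} {P : Pred (List (Fin (suc n))) 0ℓ} (P? : Decidable P) →
    (∀ {is} → HasZero is → ¬ P is) →
    length (filter P? (sequences ℓ (suc n))) ≡ length (filter (P? ∘ map suc) (sequences ℓ n))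
  sequences-suc zero    P? ¬P with does (P? [])
  ... | true  = refl
  ... | false = refl
  sequences-suc (suc ℓ) {n} P? ¬P = begin
    length (filter P? (sequences (suc ℓ) (suc n)))
      ≡⟨ length-filter-∷ P? (allFin (suc n)) (sequences ℓ (suc n)) ⟩
    sum (map f (allFin (suc n)))
      ≡⟨ sum-allFin n f ⟩
    f zero + sum (map (f ∘ suc) (allFin n))
      ≡⟨ cong (_+ sum (map (f ∘ suc) (allFin n))) (length-filter-∅ (P? ∘ (zero ∷_)) (λ _ → ¬P here) (sequences ℓ (suc n))) ⟩
    sum (map (f ∘ suc) (allFin n))
      ≡⟨ cong sum (map-cong (λ i → sequences-suc ℓ (P? ∘ (suc i ∷_)) (¬P ∘ there)) (allFin n)) ⟩
    sum (map (λ i → length (filter (P? ∘ map suc ∘ (i ∷_)) (sequences ℓ n))) (allFin n))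
      ≡⟨ length-filter-∷ (P? ∘ map suc) (allFin n) (sequences ℓ n) ⟨
    length (filter (P? ∘ map suc) (sequences (suc ℓ) n)) ∎
    where
    open ≡-Reasoning
    f : Fin (suc n) → ℕ
    f i = length (filter (P? ∘ (i ∷_)) (sequences ℓ (suc n)))

  module _ {n : ℕ} where

    open import Data.Fin using (_<_)

    linked-positive : ∀ {i : Fin (suc n)} {is} → Linked _<_ (i ∷ is) → ¬ HasZero is
    linked-positive (() ∷ l) here
    linked-positive (_ ∷ l)  (there h) = linked-positive l h

    linked-map-suc⁻ : ∀ (is : List (Fin n)) → Linked _<_ (map suc is) → Linked _<_ is
    linked-map-suc⁻ []           l       = []
    linked-map-suc⁻ (i ∷ [])     l       = [-]
    linked-map-suc⁻ (i ∷ j ∷ is) (lt ∷ l) = s≤s⁻¹ lt ∷ linked-map-suc⁻ (j ∷ is) l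

    linked-map-suc⁺ : ∀ {is : List (Fin n)} → Linked _<_ is → Linked _<_ (map suc is)
    linked-map-suc⁺ []       = []
    linked-map-suc⁺ [-]      = [-]
    linked-map-suc⁺ (lt ∷ l) = s≤s lt ∷ linked-map-suc⁺ l

    linked-zero⁺ : ∀ {is : List (Fin n)} → Linked _<_ is → Linked _<_ (zero ∷ map suc is)
    linked-zero⁺ []       = [-]
    linked-zero⁺ [-]      = s≤s z≤n ∷ [-]
    linked-zero⁺ (lt ∷ l) = s≤s z≤n ∷ linked-map-suc⁺ (lt ∷ l)

  module _ (p w : Word) (a b : Bool) where

    private
      lookup-suc : ∀ is → map (lookup (b ∷ w)) (map suc is) ≡ map (lookup w) is
      lookup-suc is = sym (map-∘ is)

    IsOccurrence-skip : ∀ is → IsOccurrence (a ∷ p) (b ∷ w) (map suc is) ⇔ IsOccurrence (a ∷ p) w is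
    IsOccurrence-skip is = mk⇔
      (λ (l , eq) → linked-map-suc⁻ is l , trans (sym (lookup-suc is)) eq)
      (λ (l , eq) → linked-map-suc⁺ l , trans (lookup-suc is) eq)

    IsOccurrence-take : b ≡ a → ∀ is → IsOccurrence (a ∷ p) (b ∷ w) (zero ∷ map suc is) ⇔ IsOccurrence p w is
    IsOccurrence-take b≡a is = mk⇔
      (λ (l , eq) → linked-map-suc⁻ is (tail l) , trans (sym (lookup-suc is)) (∷-injectiveʳ eq))
      (λ (l , eq) → linked-zero⁺ l , cong₂ _∷_ b≡a (trans (lookup-suc is) eq))

  occurrences≡count : ∀ p w → occurrences p w ≡ count p w
  occurrences≡count []      w       = refl
  occurrences≡count (a ∷ p) []      = refl
  occurrences≡count (a ∷ p) (b ∷ w) = begin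
    occurrences (a ∷ p) (b ∷ w)
      ≡⟨ length-filter-∷ P? (allFin (suc n)) S ⟩
    sum (map f (allFin (suc n)))
      ≡⟨ sum-allFin n f ⟩
    f zero + sum (map (f ∘ suc) (allFin n))
      ≡⟨ cong₂ _+_ (first (b ≟ᴮ a)) rest ⟩
    count (a ∷ p) (b ∷ w) ∎
    where
    open ≡-Reasoning
    n = length w
    S = sequences (length p) (suc n)
    P? = isOccurrence? (a ∷ p) (b ∷ w)
    f : Fin (suc n) → ℕ
    f i = length (filter (P? ∘ (i ∷_)) S)

    first : (d : Dec (b ≡ a)) → f zero ≡ (if does d then count p w else 0)
    first (yes b≡a) = begin
      f zero
        ≡⟨ sequences-suc (length p) (P? ∘ (zero ∷_)) (λ h (l , _) → linked-positive l h) ⟩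
      length (filter (P? ∘ (zero ∷_) ∘ map suc) (sequences (length p) n))
        ≡⟨ length-filter-⇔ (P? ∘ (zero ∷_) ∘ map suc) (isOccurrence? p w)
             (IsOccurrence-take p w a b b≡a) (sequences (length p) n) ⟩
      occurrences p w
        ≡⟨ occurrences≡count p w ⟩
      count p w ∎
    first (no b≢a) = length-filter-∅ (P? ∘ (zero ∷_)) (λ is (_ , eq) → b≢a (∷-injectiveˡ eq)) S

    rest : sum (map (f ∘ suc) (allFin n)) ≡ count (a ∷ p) w
    rest = begin
      sum (map (f ∘ suc) (allFin n))
        ≡⟨ cong sum (map-cong (λ i → sequences-suc (length p) (P? ∘ (suc i ∷_))
             (λ h (l , _) → linked-positive l h)) (allFin n)) ⟩
      sum (map (λ i → length (filter (P? ∘ map suc ∘ (i ∷_)) (sequences (length p) n))) (allFin n))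
        ≡⟨ length-filter-∷ (P? ∘ map suc) (allFin n) (sequences (length p) n) ⟨
      length (filter (P? ∘ map suc) (sequences (suc (length p)) n))
        ≡⟨ length-filter-⇔ (P? ∘ map suc) (isOccurrence? (a ∷ p) w)
             (IsOccurrence-skip p w a b) (sequences (suc (length p)) n) ⟩
      occurrences (a ∷ p) w
        ≡⟨ occurrences≡count (a ∷ p) w ⟩
      count (a ∷ p) w ∎

-- Run-length encoding and removal of the negligible boundary runs

module Runs where

  open Occurrences
  open import Defs using (Letter; Word; runs; numRuns; runLengths; Alternating; dropFirstIf; dropLastIf; removeNBRs)
  open import Data.Bool using (true; false; not; if_then_else_)
  open import Data.Bool.Properties using (not-involutive; not-injective; not-¬; ¬-not) renaming (_≟_ to _≟ᴮ_)
  open import Data.List using (List; []; _∷_; _++_; _∷ʳ_; map; concat; length; replicate; reverse; initLast; _∷ʳ′_)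
  open import Data.List.NonEmpty as List⁺ using (List⁺; toList; head; last; groupSeqs; snocView; _∷⁺_)
  open import Data.List.Properties using (++-assoc; ++-identityʳ; reverse-++; reverse-involutive; ∷ʳ-injectiveʳ; ∷ʳ-++; ∷-injectiveˡ; length-map; length-++; length-replicate)
  open import Data.List.Relation.Unary.All as All using (All; []; _∷_)
  open import Data.List.Relation.Unary.All.Properties using (∷ʳ⁻; map⁻)
  open import Data.Nat using (ℕ; zero; suc; _+_; _<_; z≤n; s≤s)
  open import Data.Nat.Properties using (+-suc; +-comm; suc-injective)
  open import Data.Product using (∃-syntax; _×_; _,_; proj₁)
  open import Data.Sum using (_⊎_; inj₁; inj₂; reduce)
  open import Function using (_∘_)
  open import Relation.Binary.PropositionalEquality
  open import Relation.Nullary using (Dec; yes; no; does; contradiction; ¬?)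
  open import Relation.Nullary.Decidable using (dec-false)

  -- A run of length l + 1 is encoded by l.
  expand : Letter → List ℕ → Word
  expand b []       = []
  expand b (l ∷ ls) = replicate (suc l) b ++ expand (not b) ls

  represent : ∀ w → ∃[ b ] ∃[ ls ] w ≡ expand b ls
  represent []      = true , [] , refl
  represent (x ∷ w) with represent w
  ... | b , []     , refl = x , 0 ∷ [] , refl
  ... | b , l ∷ ls , refl with x ≟ᴮ b
  ...   | yes refl = x , suc l ∷ ls , refl
  ...   | no  x≢b  = x , 0 ∷ l ∷ ls , cong (λ c → x ∷ expand c (l ∷ ls))
                       (trans (sym (not-involutive b)) (cong not (sym (¬-not x≢b))))

  runsOf : Letter → List ℕ → List (List⁺ Letter)
  runsOf b []       = []
  runsOf b (l ∷ ls) = (b List⁺.∷ replicate l b) ∷ runsOf (not b) ls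

  private
    groups : Word → List (List⁺ Letter ⊎ List⁺ Letter)
    groups = groupSeqs (_≟ᴮ true)

    tag : Letter → List⁺ Letter → List⁺ Letter ⊎ List⁺ Letter
    tag true  = inj₁
    tag false = inj₂

    -- `groupSeqs` merges a letter into the next block by comparing tags, so the induction has to
    -- keep them; `reduce` comes only at the end.
    taggedRuns : Letter → List ℕ → List (List⁺ Letter ⊎ List⁺ Letter)
    taggedRuns b []       = []
    taggedRuns b (l ∷ ls) = tag b (b List⁺.∷ replicate l b) ∷ taggedRuns (not b) ls

    groups-extend : ∀ b w u xss → groups w ≡ tag b u ∷ xss → groups (b ∷ w) ≡ tag b (b ∷⁺ u) ∷ xss
    groups-extend true  w u xss eq rewrite eq = refl
    groups-extend false w u xss eq rewrite eq = refl

    groups-start : ∀ b w ls → groups w ≡ taggedRuns (not b) ls →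
      groups (b ∷ w) ≡ tag b (b List⁺.∷ []) ∷ taggedRuns (not b) ls
    groups-start true  w []       eq rewrite eq = refl
    groups-start true  w (l ∷ ls) eq rewrite eq = refl
    groups-start false w []       eq rewrite eq = refl
    groups-start false w (l ∷ ls) eq rewrite eq = refl

    groups-expand : ∀ b ls → groups (expand b ls) ≡ taggedRuns b ls
    groups-expand b []       = refl
    groups-expand b (l ∷ ls) = go l
      where
      go : ∀ l → groups (expand b (l ∷ ls)) ≡ taggedRuns b (l ∷ ls)
      go zero    = groups-start b (expand (not b) ls) ls (groups-expand (not b) ls)
      go (suc l) = groups-extend b (expand b (l ∷ ls)) _ _ (go l)

    reduce-tag : ∀ b u → reduce (tag b u) ≡ u
    reduce-tag true  u = refl
    reduce-tag false u = refl

    untag : ∀ b ls → map reduce (taggedRuns b ls) ≡ runsOf b ls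
    untag b []       = refl
    untag b (l ∷ ls) = cong₂ _∷_ (reduce-tag b _) (untag (not b) ls)

  runs-expand : ∀ b ls → runs (expand b ls) ≡ runsOf b ls
  runs-expand b ls = trans (cong (map reduce) (groups-expand b ls)) (untag b ls)

  lengths-runsOf : ∀ b ls → map List⁺.length (runsOf b ls) ≡ map suc ls
  lengths-runsOf b []       = refl
  lengths-runsOf b (l ∷ ls) = cong₂ _∷_ (cong suc (length-replicate l)) (lengths-runsOf (not b) ls)

  runLengths-expand : ∀ b ls → runLengths (expand b ls) ≡ map suc ls
  runLengths-expand b ls = trans (cong (map List⁺.length) (runs-expand b ls)) (lengths-runsOf b ls)

  numRuns-expand : ∀ b ls → numRuns (expand b ls) ≡ length ls
  numRuns-expand b ls = begin
    numRuns (expand b ls)             ≡⟨ length-map List⁺.length (runs (expand b ls)) ⟨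
    length (runLengths (expand b ls)) ≡⟨ cong length (runLengths-expand b ls) ⟩
    length (map suc ls)               ≡⟨ length-map suc ls ⟩
    length ls                         ∎
    where open ≡-Reasoning

  alternating-expand : ∀ b ls → Alternating (expand b ls) → All (_≡ 0) ls
  alternating-expand b ls alt =
    All.map suc-injective (map⁻ (subst (All (_≡ 1)) (runLengths-expand b ls) alt))

  concat-runsOf : ∀ b ls → concat (map toList (runsOf b ls)) ≡ expand b ls
  concat-runsOf b []       = refl
  concat-runsOf b (l ∷ ls) = cong (replicate (suc l) b ++_) (concat-runsOf (not b) ls)

  -- The letter of run number `n`, counted from 0, in a word whose first run consists of `b`.
  flips : Letter → ℕ → Letter
  flips b zero    = b
  flips b (suc n) = not (flips b n)

  flips-not : ∀ b n → flips (not b) n ≡ not (flips b n)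
  flips-not b zero    = refl
  flips-not b (suc n) = cong not (flips-not b n)

  runsOf-∷ʳ : ∀ b ls l → let c = flips b (length ls) in
    runsOf b (ls ∷ʳ l) ≡ runsOf b ls ∷ʳ (c List⁺.∷ replicate l c)
  runsOf-∷ʳ b []        l = refl
  runsOf-∷ʳ b (l′ ∷ ls) l
    rewrite runsOf-∷ʳ (not b) ls l | flips-not b (length ls) = refl

  expand-∷ʳ : ∀ b ls l → expand b (ls ∷ʳ l) ≡ expand b ls ++ replicate (suc l) (flips b (length ls))
  expand-∷ʳ b []        l = ++-identityʳ (replicate (suc l) b)
  expand-∷ʳ b (l′ ∷ ls) l = begin
    replicate (suc l′) b ++ expand (not b) (ls ∷ʳ l)
      ≡⟨ cong (replicate (suc l′) b ++_) (expand-∷ʳ (not b) ls l) ⟩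
    replicate (suc l′) b ++ (expand (not b) ls ++ replicate (suc l) (flips (not b) (length ls)))
      ≡⟨ ++-assoc (replicate (suc l′) b) _ _ ⟨
    expand b (l′ ∷ ls) ++ replicate (suc l) (flips (not b) (length ls))
      ≡⟨ cong (λ c → expand b (l′ ∷ ls) ++ replicate (suc l) c) (flips-not b (length ls)) ⟩
    expand b (l′ ∷ ls) ++ replicate (suc l) (flips b (length (l′ ∷ ls))) ∎
    where open ≡-Reasoning

  -- The possible numbers n of runs of a word in which the boundary runs match
  -- those of a pattern with r runs; n < r covers the empty word.
  Matches : ℕ → ℕ → Set
  Matches r n = (∃[ s ] n ≡ s + s + r) ⊎ n < r

  -- `flips b` has period 2, so equal letters mean equal parity. Peeling both numbers leaves an even
  -- surplus `s + s`, unless `m` runs out first.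
  flips-matches : ∀ b m n → flips b m ≡ flips b n → Matches n m
  flips-matches b zero          zero    eq = inj₁ (0 , refl)
  flips-matches b (suc zero)    zero    eq = contradiction (sym eq) (not-¬ refl)
  flips-matches b (suc (suc m)) zero    eq
    with flips-matches b m zero (trans (sym (not-involutive (flips b m))) eq)
  ... | inj₁ (s , refl) = inj₁ (suc s , cong (λ k → suc (k + 0)) (sym (+-suc s s)))
  flips-matches b zero          (suc n) eq = inj₂ (s≤s z≤n)
  flips-matches b (suc m)       (suc n) eq with flips-matches b m n (not-injective eq)
  ... | inj₁ (s , refl) = inj₁ (s , sym (+-suc (s + s) n))
  ... | inj₂ m<n        = inj₂ (s≤s m<n)

  count-skip : ∀ a p n w → count (a ∷ p) (replicate n (not a) ++ w) ≡ count (a ∷ p) w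
  count-skip a p zero    w = refl
  count-skip a p (suc n) w rewrite dec-false (not a ≟ᴮ a) (not-¬ refl ∘ sym) = count-skip a p n w

  private
    -- An occurrence using the final letter would match it with `x`. Since `count` consumes the word
    -- from the left, this is an induction of its own rather than a mirror image of `count-skip`.
    count-skip-∷ʳ : ∀ p x b → x ≢ b → ∀ w → count (p ∷ʳ x) (w ∷ʳ b) ≡ count (p ∷ʳ x) w
    count-skip-∷ʳ []           x b x≢b []      rewrite dec-false (b ≟ᴮ x) (x≢b ∘ sym) = refl
    count-skip-∷ʳ (a ∷ [])     x b x≢b []      with b ≟ᴮ a
    ... | yes _ = refl
    ... | no _  = refl
    count-skip-∷ʳ (a ∷ c ∷ p)  x b x≢b []      with b ≟ᴮ a
    ... | yes _ = refl
    ... | no _  = refl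
    count-skip-∷ʳ []           x b x≢b (y ∷ w) rewrite count-skip-∷ʳ [] x b x≢b w = refl
    count-skip-∷ʳ (a ∷ p)      x b x≢b (y ∷ w)
      rewrite count-skip-∷ʳ (a ∷ p) x b x≢b w | count-skip-∷ʳ p x b x≢b w = refl

  toList-last : (u : List⁺ Letter) → ∃[ v ] toList u ≡ v ∷ʳ last u
  toList-last u with snocView u
  ... | []      List⁺.∷ʳ′ y = [] , refl
  ... | (x ∷ v) List⁺.∷ʳ′ y = x ∷ v , refl

  count-skip-last : ∀ (p : List⁺ Letter) n b w → last p ≢ b →
    count (toList p) (w ++ replicate n b) ≡ count (toList p) w
  count-skip-last p zero    b w last≢b = cong (count (toList p)) (++-identityʳ w)
  count-skip-last p (suc n) b w last≢b = begin
    count (toList p) (w ++ b ∷ replicate n b)    ≡⟨ cong (count (toList p)) (∷ʳ-++ w b (replicate n b)) ⟨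
    count (toList p) (w ∷ʳ b ++ replicate n b)   ≡⟨ count-skip-last p n b (w ∷ʳ b) last≢b ⟩
    count (toList p) (w ∷ʳ b)                    ≡⟨ last-letter ⟩
    count (toList p) w                           ∎
    where
    open ≡-Reasoning
    last-letter : count (toList p) (w ∷ʳ b) ≡ count (toList p) w
    last-letter with toList-last p
    ... | v , eq rewrite eq = count-skip-∷ʳ v (last p) b last≢b w

  replicate-∷ʳ : ∀ n (b : Letter) → b ∷ replicate n b ≡ replicate n b ∷ʳ b
  replicate-∷ʳ zero    b = refl
  replicate-∷ʳ (suc n) b = cong (b ∷_) (replicate-∷ʳ n b)

  last-unique : ∀ (u : List⁺ Letter) {v x} → toList u ≡ v ∷ʳ x → last u ≡ x
  last-unique u {v} eq with toList-last u
  ... | v′ , eq′ = ∷ʳ-injectiveʳ v′ v (trans (sym eq′) eq)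

  last-replicate : ∀ b n → last (b List⁺.∷ replicate n b) ≡ b
  last-replicate b n = last-unique (b List⁺.∷ replicate n b) (replicate-∷ʳ n b)

  head-expand : ∀ (p : List⁺ Letter) b ks → toList p ≡ expand b ks → head p ≡ b
  head-expand p b (k ∷ ks) eq = ∷-injectiveˡ eq

  -- The last run has number `length ks` minus 1; negating its letter moves to `length ks` and
  -- avoids the subtraction.
  last-expand : ∀ (p : List⁺ Letter) b ks → toList p ≡ expand b ks → not (last p) ≡ flips b (length ks)
  last-expand p b ks eq with initLast ks
  ... | ks′ ∷ʳ′ k = begin
    not (last p)                     ≡⟨ cong not (last-unique p eq′) ⟩
    not (flips b (length ks′))       ≡⟨ cong (flips b) (trans (length-++ ks′) (+-comm (length ks′) 1)) ⟨
    flips b (length (ks′ ∷ʳ k))      ∎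
    where
    open ≡-Reasoning
    c = flips b (length ks′)
    eq′ : toList p ≡ (expand b ks′ ++ replicate k c) ∷ʳ c
    eq′ = begin
      toList p                                ≡⟨ eq ⟩
      expand b (ks′ ∷ʳ k)                     ≡⟨ expand-∷ʳ b ks′ k ⟩
      expand b ks′ ++ replicate (suc k) c     ≡⟨ cong (expand b ks′ ++_) (replicate-∷ʳ k c) ⟩
      expand b ks′ ++ (replicate k c ∷ʳ c)    ≡⟨ ++-assoc (expand b ks′) _ _ ⟨
      (expand b ks′ ++ replicate k c) ∷ʳ c    ∎

  module _ (p : List⁺ Letter) (b : Letter) (ks : List ℕ) (p≡ : toList p ≡ expand b ks) where

    private
      first? = λ (u : List⁺ Letter) → ¬? (head u ≟ᴮ head p)
      last?  = λ (u : List⁺ Letter) → ¬? (last u ≟ᴮ last p)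

    -- Either the first run already consists of `b`, the first letter of `p`, or it is dropped and
    -- the next run does. Closure under `All P` carries alternation over to the shortened word.
    dropFirst : ∀ a ls → ∃[ ms ]
      dropFirstIf first? (runsOf a ls) ≡ runsOf b ms ×
      count (toList p) (expand a ls) ≡ count (toList p) (expand b ms) ×
      (∀ {P : ℕ → Set} → All P ls → All P ms)
    dropFirst a []       = [] , refl , refl , λ ps → ps
    dropFirst a (l ∷ ls) = go (a ≟ᴮ head p)
      where
      go : (a≟ : Dec (a ≡ head p)) → ∃[ ms ]
        (if does (¬? a≟) then runsOf (not a) ls else runsOf a (l ∷ ls)) ≡ runsOf b ms ×
        count (toList p) (expand a (l ∷ ls)) ≡ count (toList p) (expand b ms) ×
        (∀ {P : ℕ → Set} → All P (l ∷ ls) → All P ms)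
      go (yes a≡) = l ∷ ls , cong (λ c → runsOf c (l ∷ ls)) a≡b
                   , cong (λ c → count (toList p) (expand c (l ∷ ls))) a≡b , λ ps → ps
        where
        a≡b : a ≡ b
        a≡b = trans a≡ (head-expand p b ks p≡)
      go (no a≢) = ls , cong (λ c → runsOf c ls) not-a≡b , eq , All.tail
        where
        not-a≡b : not a ≡ b
        not-a≡b = trans (sym (¬-not (a≢ ∘ sym))) (head-expand p b ks p≡)
        eq : count (toList p) (expand a (l ∷ ls)) ≡ count (toList p) (expand b ls)
        eq rewrite ¬-not a≢ | not-involutive (head p) =
          trans (count-skip (head p) (List⁺.tail p) (suc l) (expand (head p) ls))
                (cong (λ c → count (toList p) (expand c ls)) (head-expand p b ks p≡))

    -- As both words start with `b`, comparing their last letters compares the parities of their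
    -- numbers of runs.
    dropLast : ∀ ls → ∃[ ms ]
      dropLastIf last? (runsOf b ls) ≡ runsOf b ms ×
      count (toList p) (expand b ls) ≡ count (toList p) (expand b ms) ×
      Matches (length ks) (length ms) ×
      (∀ {P : ℕ → Set} → All P ls → All P ms)
    dropLast ls with initLast ls
    dropLast .[] | [] = [] , refl , refl , nonempty ks p≡ , λ ps → ps
      where
      nonempty : ∀ ks → toList p ≡ expand b ks → Matches (length ks) 0
      nonempty (_ ∷ _) _ = inj₂ (s≤s z≤n)
    dropLast .(ls ∷ʳ l) | ls ∷ʳ′ l rewrite runsOf-∷ʳ b ls l
      | reverse-++ (runsOf b ls) ((flips b (length ls) List⁺.∷ replicate l (flips b (length ls))) ∷ [])
      | last-replicate (flips b (length ls)) l
      with flips b (length ls) ≟ᴮ last p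
    ... | yes eq = ls ∷ʳ l , kept , refl , matches , λ ps → ps
      where
      u = flips b (length ls) List⁺.∷ replicate l (flips b (length ls))
      kept : reverse (u ∷ reverse (runsOf b ls)) ≡ runsOf b (ls ∷ʳ l)
      kept = trans (reverse-++ (u ∷ []) (reverse (runsOf b ls)))
               (trans (cong (_∷ʳ u) (reverse-involutive (runsOf b ls))) (sym (runsOf-∷ʳ b ls l)))
      matches : Matches (length ks) (length (ls ∷ʳ l))
      -- The number of runs indexes the letter that would follow the last run, hence the negation on
      -- both sides.
      matches = flips-matches b _ _
        (trans (cong (flips b) (trans (length-++ ls) (+-comm (length ls) 1)))
               (trans (cong not eq) (last-expand p b ks p≡)))
    -- The discarded run has number `length ls`, so its letter, opposite to the last of `p`, is
    -- already the one to compare.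
    ... | no neq = ls , reverse-involutive (runsOf b ls)
      , trans (cong (count (toList p)) (expand-∷ʳ b ls l)) (count-skip-last p (suc l) _ (expand b ls) (neq ∘ sym))
      , flips-matches b _ _ (trans (¬-not neq) (last-expand p b ks p≡))
      , λ ps → proj₁ (∷ʳ⁻ ps)

    removeNBRs-expand : ∀ a ls → ∃[ ms ]
      removeNBRs p (expand a ls) ≡ expand b ms ×
      count (toList p) (expand a ls) ≡ count (toList p) (expand b ms) ×
      Matches (length ks) (length ms) ×
      (∀ {P : ℕ → Set} → All P ls → All P ms)
    removeNBRs-expand a ls with dropFirst a ls
    ... | ls₁ , runs₁ , count₁ , all₁ with dropLast ls₁
    ...   | ms , runs₂ , count₂ , matches , all₂ = ms , eq , trans count₁ count₂ , matches , λ ps → all₂ (all₁ ps)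
      where
      eq : removeNBRs p (expand a ls) ≡ expand b ms
      eq rewrite runs-expand a ls | runs₁ | runs₂ = concat-runsOf b ms

-- Bounding occurrences by sums over profiles; the exact count for alternating words

module Embeddings where

  open Occurrences
  open Runs
  open import Defs using (Letter; Word)
  open import Data.Bool using (not; if_then_else_)
  open import Data.Bool.Properties using (not-involutive; not-¬) renaming (_≟_ to _≟ᴮ_)
  open import Data.List using (List; []; _∷_; _++_; length; replicate)
  open import Data.List.Relation.Unary.All using (All; []; _∷_)
  open import Data.Nat
  open import Data.Nat.Combinatorics using (_C_; nCk+nC[k+1]≡[n+1]C[k+1]; k>n⇒nCk≡0)
  open import Data.Nat.Properties
  open import Data.Nat.Tactic.RingSolver using (solve-∀)
  open import Function using (_∘_)
  open import Relation.Binary.PropositionalEquality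
  open import Relation.Nullary using (yes; no; does)
  open import Relation.Nullary.Decidable using (dec-true; dec-false)

  pascal : ∀ n k → suc n C suc k ≡ n C k + n C suc k
  pascal n k = sym (nCk+nC[k+1]≡[n+1]C[k+1] n k)

  C-suc : ∀ n k → n C k ≤ suc n C k
  C-suc n zero    = ≤-refl
  C-suc n (suc k) = ≤-trans (m≤n+m (n C suc k) (n C k)) (≤-reflexive (sym (pascal n k)))

  C-monoˡ : ∀ k {m n} → m ≤′ n → m C k ≤ n C k
  C-monoˡ k ≤′-refl       = ≤-refl
  C-monoˡ k (≤′-step m≤n) = ≤-trans (C-monoˡ k m≤n) (C-suc _ k)

  -- Sums, over the letters b of the word, the number of ways to put k more
  -- letters b before it, a of them being available before the word starts,
  -- times the number of occurrences of p after it.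
  lastOfRun : ℕ → ℕ → Letter → Word → Word → ℕ
  lastOfRun k a b p []      = 0
  lastOfRun k a b p (x ∷ w) =
    if does (x ≟ᴮ b) then (a C k) * count p w + lastOfRun k (suc a) b p w
                     else lastOfRun k a b p w

  module _ (b : Letter) (p : Word) where

    lastOfRun-zero : ∀ a a′ w → lastOfRun 0 a b p w ≡ lastOfRun 0 a′ b p w
    lastOfRun-zero a a′ []      = refl
    lastOfRun-zero a a′ (x ∷ w) with x ≟ᴮ b
    ... | yes _ = cong (1 * count p w +_) (lastOfRun-zero (suc a) (suc a′) w)
    ... | no  _ = lastOfRun-zero a a′ w

    -- Pascal's rule for `k + 1` letters out of `a + 1`: the additional available letter is chosen
    -- or not.
    lastOfRun-pascal : ∀ k a w →
      lastOfRun (suc k) (suc a) b p w ≡ lastOfRun k a b p w + lastOfRun (suc k) a b p w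
    lastOfRun-pascal k a []      = refl
    lastOfRun-pascal k a (x ∷ w) with x ≟ᴮ b
    ... | no  _ = lastOfRun-pascal k a w
    ... | yes _ rewrite pascal a k | lastOfRun-pascal k (suc a) w =
      regroup (a C k) (a C suc k) (count p w) (lastOfRun k (suc a) b p w) (lastOfRun (suc k) (suc a) b p w)
      where
      regroup : ∀ x y c u v → (x + y) * c + (u + v) ≡ (x * c + u) + (y * c + v)
      regroup = solve-∀

    -- Occurrences are sorted by the place of the last letter of the first pattern run, whereas
    -- `count` decides on the first letter; `lastOfRun-pascal` reconciles the two.
    count-lastOfRun : ∀ k w → count (replicate (suc k) b ++ p) w ≡ lastOfRun k 0 b p w
    count-lastOfRun k       []      = refl
    count-lastOfRun zero    (x ∷ w) with x ≟ᴮ b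
    ... | yes _ = cong₂ _+_ (sym (*-identityˡ (count p w)))
                    (trans (count-lastOfRun 0 w) (lastOfRun-zero 0 1 w))
    ... | no  _ = count-lastOfRun 0 w
    count-lastOfRun (suc k) (x ∷ w) with x ≟ᴮ b
    ... | yes _ = trans (cong₂ _+_ (count-lastOfRun k w) (count-lastOfRun (suc k) w))
                    (sym (lastOfRun-pascal k 0 w))
    ... | no  _ = count-lastOfRun (suc k) w

    lastOfRun-skip : ∀ k a n w → lastOfRun k a b p (replicate n (not b) ++ w) ≡ lastOfRun k a b p w
    lastOfRun-skip k a zero    w = refl
    lastOfRun-skip k a (suc n) w
      rewrite dec-false (not b ≟ᴮ b) (not-¬ refl ∘ sym) = lastOfRun-skip k a n w

    -- A letter is not among its own predecessors: at offset j < l it has a + j ≤ N of them. The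
    -- letters of the run after it add no occurrences of `p`, which is the second hypothesis.
    lastOfRun-run : ∀ k l a N rest → a + l ≤ suc N →
      (∀ n → count p (replicate n b ++ rest) ≡ count p rest) →
      lastOfRun k a b p (replicate l b ++ rest) ≤
      l * ((N C k) * count p rest) + lastOfRun k (a + l) b p rest
    lastOfRun-run k zero    a N rest a≤ skip =
      ≤-reflexive (cong (λ a → lastOfRun k a b p rest) (sym (+-identityʳ a)))
    lastOfRun-run k (suc l) a N rest a≤ skip
      rewrite dec-true (b ≟ᴮ b) refl | skip l | +-suc a l | +-assoc ((N C k) * count p rest) (l * ((N C k) * count p rest)) (lastOfRun k (suc (a + l)) b p rest) =
      +-mono-≤ (*-monoˡ-≤ (count p rest) (C-monoˡ k (≤⇒≤′ (≤-trans (m≤m+n a l) (s≤s⁻¹ a≤)))))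
               (lastOfRun-run k l (suc a) N rest a≤ skip)

  -- Σ f t * e (n ∸ (2 t + 1)) over the t with 2 t + 1 ≤ n
  oddSum : (ℕ → ℕ) → (ℕ → ℕ) → ℕ → ℕ
  oddSum f e zero          = 0
  oddSum f e (suc zero)    = f 0 * e 0
  oddSum f e (suc (suc n)) = f 0 * e (suc n) + oddSum (f ∘ suc) e n

  -- Bounds the number of ways to place a pattern run of length k + 1 such that
  -- its last letter lies in run 2 t of a word with runs of length at most M.
  placements : ℕ → ℕ → ℕ → ℕ
  placements M k t = M * ((M * suc t ∸ 1) C k)

  -- Ending the first pattern run in run 2 t uses up 2 t + 1 runs, and the rest of the pattern
  -- starts with the letter of the next one.
  embeddings : ℕ → List ℕ → ℕ → ℕ
  embeddings M []       n = 1
  embeddings M (k ∷ ks) n = oddSum (placements M k) (embeddings M ks) n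

  private
    room : ∀ M a m t → a ≤ M * t → suc m ≤ M → a + suc m ≤ M * suc t
    room M a m t a≤ m<M rewrite *-suc M t | +-comm M (M * t) = +-mono-≤ a≤ m<M

    count-after-run : ∀ b ks n w → count (expand (not b) ks) (replicate n b ++ w) ≡ count (expand (not b) ks) w
    count-after-run b []       n w = refl
    count-after-run b (k ∷ ks) n w = trans
      (cong (λ c → count (expand (not b) (k ∷ ks)) (replicate n c ++ w)) (sym (not-involutive b)))
      (count-skip (not b) (replicate k (not b) ++ expand (not (not b)) ks) n w)

  module _ {M : ℕ} where

    ShortRuns : List ℕ → Set
    ShortRuns = All (λ m → suc m ≤ M)

    -- Here `t` counts the runs of `b` already passed, `a` the letters in them, and `f` dominates
    -- `placements M k` shifted by `t`, so that each recursive call again faces an `oddSum` from its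
    -- start.
    lastOfRun≤oddSum : ∀ b k ks (e : ℕ → ℕ) →
      (∀ ms → ShortRuns ms → count (expand (not b) ks) (expand (not b) ms) ≤ e (length ms)) →
      ∀ t f a → a ≤ M * t → (∀ t′ → placements M k (t′ + t) ≤ f t′) →
      ∀ ms → ShortRuns ms → lastOfRun k a b (expand (not b) ks) (expand b ms) ≤ oddSum f e (length ms)
    lastOfRun≤oddSum b k ks e e≥ t f a a≤ f≥ []       []         = z≤n
    lastOfRun≤oddSum b k ks e e≥ t f a a≤ f≥ (m ∷ ms) (m<M ∷ ms<) = begin
      lastOfRun k a b p (expand b (m ∷ ms))
        ≤⟨ lastOfRun-run b p k (suc m) a N rest bounded (λ n → count-after-run b ks n rest) ⟩
      suc m * ((N C k) * count p rest) + lastOfRun k (a + suc m) b p rest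
        ≤⟨ +-monoˡ-≤ _ head≤ ⟩
      f 0 * e (length ms) + lastOfRun k (a + suc m) b p rest
        ≤⟨ tail≤ ms ms< ⟩
      oddSum f e (length (m ∷ ms)) ∎
      where
      open ≤-Reasoning
      p = expand (not b) ks
      rest = expand (not b) ms
      -- At most `M * suc t` letters `b` lie in the runs up to the current one, and one of them is
      -- the last letter itself.
      N = M * suc t ∸ 1
      bounded : a + suc m ≤ suc N
      bounded = ≤-trans (room M a m t a≤ m<M) (suc-pred-≤ (M * suc t))
        where
        suc-pred-≤ : ∀ n → n ≤ suc (n ∸ 1)
        suc-pred-≤ zero    = z≤n
        suc-pred-≤ (suc n) = ≤-refl
      head≤ : suc m * ((N C k) * count p rest) ≤ f 0 * e (length ms)
      head≤ = begin
        suc m * ((N C k) * count p rest)   ≤⟨ *-monoˡ-≤ _ m<M ⟩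
        M * ((N C k) * count p rest)       ≡⟨ *-assoc M (N C k) (count p rest) ⟨
        M * (N C k) * count p rest       ≤⟨ *-mono-≤ (f≥ 0) (e≥ ms ms<) ⟩
        f 0 * e (length ms)              ∎
      -- The following run consists of `not b` and holds no last letter, so two runs are consumed at
      -- a time.
      tail≤ : ∀ ms → ShortRuns ms →
        f 0 * e (length ms) + lastOfRun k (a + suc m) b p (expand (not b) ms) ≤ oddSum f e (suc (length ms))
      tail≤ []        []           = ≤-reflexive (+-identityʳ (f 0 * e 0))
      tail≤ (m′ ∷ ms) (_ ∷ ms<)
        rewrite lastOfRun-skip b p k (a + suc m) (suc m′) (expand (not (not b)) ms) | not-involutive b =
        +-monoʳ-≤ (f 0 * e (suc (length ms)))
          (lastOfRun≤oddSum b k ks e e≥ (suc t) (f ∘ suc) (a + suc m) (room M a m t a≤ m<M)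
            (λ t′ → subst (λ u → placements M k u ≤ f (suc t′)) (sym (+-suc t′ t)) (f≥ (suc t′))) ms ms<)

    count≤embeddings : ∀ ks b ms → ShortRuns ms → count (expand b ks) (expand b ms) ≤ embeddings M ks (length ms)
    count≤embeddings []       b ms ms< = ≤-refl
    count≤embeddings (k ∷ ks) b ms ms< = ≤-trans
      (≤-reflexive (count-lastOfRun b (expand (not b) ks) k (expand b ms)))
      (lastOfRun≤oddSum b k ks (embeddings M ks) (count≤embeddings ks (not b)) 0 (placements M k) 0 z≤n
        (λ t′ → ≤-reflexive (cong (placements M k) (+-identityʳ t′))) ms ms<)

  convolution : (ℕ → ℕ) → (ℕ → ℕ) → ℕ → ℕ
  convolution f e zero    = f 0 * e 0
  convolution f e (suc s) = f 0 * e (suc s) + convolution (f ∘ suc) e s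

  -- The sum of the products of placements over all t₁ + ⋯ + tᵣ ≤ s; equality is not forced because
  -- the empty pattern has value 1 at every `s`.
  profiles : ℕ → List ℕ → ℕ → ℕ
  profiles M []       s = 1
  profiles M (k ∷ ks) s = convolution (placements M k) (profiles M ks) s

  oddSum-vanishes : ∀ r e → (∀ n → n < r → e n ≡ 0) → ∀ f n → n < suc r → oddSum f e n ≡ 0
  oddSum-vanishes r e e≡0 f zero          n<r = refl
  oddSum-vanishes r e e≡0 f (suc zero)    n<r rewrite e≡0 0 (s≤s⁻¹ n<r) = *-zeroʳ (f 0)
  oddSum-vanishes r e e≡0 f (suc (suc n)) n<r
    rewrite e≡0 (suc n) (s≤s⁻¹ n<r) | *-zeroʳ (f 0) =
    oddSum-vanishes r e e≡0 (f ∘ suc) n (≤-trans (n≤1+n (suc n)) (<⇒≤ n<r))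

  -- For n = 2 s + r + 1 the remainder n - (2 t + 1) is 2 (s - t) + r if t ≤ s; for larger t it
  -- falls below `r`, where `e` vanishes.
  oddSum-convolution : ∀ r e e′ → (∀ n → n < r → e n ≡ 0) → (∀ s → e (s + s + r) ≡ e′ s) →
    ∀ f s → oddSum f e (s + s + suc r) ≡ convolution f e′ s
  oddSum-convolution zero    e e′ e≡0 e≡ f zero    = cong (f 0 *_) (e≡ 0)
  oddSum-convolution (suc r) e e′ e≡0 e≡ f zero    =
    trans (cong₂ _+_ (cong (f 0 *_) (e≡ 0)) (oddSum-vanishes (suc r) e e≡0 (f ∘ suc) r (n≤1+n (suc r))))
          (+-identityʳ _)
  oddSum-convolution r       e e′ e≡0 e≡ f (suc s)
    rewrite +-suc s s = cong₂ _+_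
      (cong (f 0 *_) (trans (cong e (shift s r)) (e≡ (suc s))))
      (oddSum-convolution r e e′ e≡0 e≡ (f ∘ suc) s)
    where
    shift : ∀ s r → suc (s + s + suc r) ≡ suc s + suc s + r
    shift = solve-∀

  embeddings-vanishes : ∀ M ks n → n < length ks → embeddings M ks n ≡ 0
  embeddings-vanishes M (k ∷ ks) = oddSum-vanishes (length ks) (embeddings M ks) (embeddings-vanishes M ks) (placements M k)

  embeddings-profiles : ∀ M ks s → embeddings M ks (s + s + length ks) ≡ profiles M ks s
  embeddings-profiles M []       s = refl
  embeddings-profiles M (k ∷ ks) s = oddSum-convolution (length ks) (embeddings M ks) (profiles M ks)
    (embeddings-vanishes M ks) (embeddings-profiles M ks) (placements M k) s

  count-match : ∀ b p w → count (b ∷ p) (b ∷ w) ≡ count p w + count (b ∷ p) w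
  count-match b p w rewrite dec-true (b ≟ᴮ b) refl = refl

  -- For lengths `suc r` and `suc (suc n)`, using the first letter leaves lengths `r` and `suc n`;
  -- passing it over, and then the mismatched next letter, leaves `suc r` and `n`. Both counts have
  -- the same upper index, as Pascal's rule requires.
  count-alternating : ∀ b r n → count (expand b (replicate r 0)) (expand b (replicate n 0)) ≡ ⌊ n + r /2⌋ C r
  count-alternating b zero    n             = refl
  count-alternating b (suc r) zero          = sym (k>n⇒nCk≡0 (⌊n/2⌋<n r))
  count-alternating b (suc r) (suc zero)    = begin
    count (expand b (replicate (suc r) 0)) (expand b (replicate 1 0))
      ≡⟨ count-match b (expand (not b) (replicate r 0)) [] ⟩
    count (expand (not b) (replicate r 0)) [] + 0
      ≡⟨ cong (_+ 0) (count-alternating (not b) r 0) ⟩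
    ⌊ r /2⌋ C r + 0
      -- The 0 is rewritten as a vanishing coefficient to complete Pascal's rule.
      ≡⟨ cong (⌊ r /2⌋ C r +_) (k>n⇒nCk≡0 (s≤s (⌊n/2⌋≤n r))) ⟨
    ⌊ r /2⌋ C r + ⌊ r /2⌋ C suc r
      ≡⟨ pascal ⌊ r /2⌋ r ⟨
    suc ⌊ r /2⌋ C suc r ∎
    where open ≡-Reasoning
  count-alternating b (suc r) (suc (suc n)) = begin
    count (expand b (replicate (suc r) 0)) (expand b (replicate (suc (suc n)) 0))
      ≡⟨ count-match b (expand (not b) (replicate r 0)) (expand (not b) (replicate (suc n) 0)) ⟩
    count (expand (not b) (replicate r 0)) (expand (not b) (replicate (suc n) 0))
      + count (expand b (replicate (suc r) 0)) (not b ∷ expand (not (not b)) (replicate n 0))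
      ≡⟨ cong₂ _+_ (count-alternating (not b) r (suc n))
           (trans (count-skip b _ 1 (expand (not (not b)) (replicate n 0)))
             (trans (cong (λ c → count (expand b (replicate (suc r) 0)) (expand c (replicate n 0))) (not-involutive b))
               (count-alternating b (suc r) n))) ⟩
    ⌊ suc n + r /2⌋ C r + ⌊ n + suc r /2⌋ C suc r
      ≡⟨ cong (λ k → ⌊ k /2⌋ C r + ⌊ n + suc r /2⌋ C suc r) (+-suc n r) ⟨
    ⌊ n + suc r /2⌋ C r + ⌊ n + suc r /2⌋ C suc r
      ≡⟨ pascal ⌊ n + suc r /2⌋ r ⟨
    suc ⌊ n + suc r /2⌋ C suc r ∎
    where open ≡-Reasoning

-- Log-concavity and the balanced profile

module Balance where

  open Embeddings
  open import Data.List using ([]; _∷_; length)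
  open import Data.List.Relation.Unary.All using (All; []; _∷_)
  open import Data.Nat
  open import Data.Nat.Combinatorics using (_C_; k>n⇒nCk≡0)
  open import Data.Nat.Properties
  open import Data.Nat.Tactic.RingSolver using (solve-∀)
  open import Data.Product using (_×_; _,_)
  open import Data.Sum using (_⊎_; inj₁; inj₂)
  open import Function using (_∘_)
  open import Relation.Binary.PropositionalEquality
  open import Relation.Nullary using (yes; no)

  ^-distribʳ-* : ∀ m n k → (m * n) ^ k ≡ m ^ k * n ^ k
  ^-distribʳ-* m n zero    = refl
  ^-distribʳ-* m n (suc k) rewrite ^-distribʳ-* m n k = regroup m n (m ^ k) (n ^ k)
    where
    regroup : ∀ m n x y → m * n * (x * y) ≡ m * x * (n * y)
    regroup = solve-∀

  -- Subtracting 0, 1, ..., k - 1 from an increasing choice of k ≤ n places leaves n + 1 - k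
  -- possible values for each entry. The proof itself runs by Pascal's rule.
  C≤^ : ∀ n k → n C k ≤ (suc n ∸ k) ^ k
  C≤^ n       zero    = ≤-refl
  C≤^ zero    (suc k) = z≤n
  C≤^ (suc n) (suc k) with k ≤? n
  ... | no k≰n  = ≤-trans (≤-reflexive (k>n⇒nCk≡0 (s≤s (≰⇒> k≰n)))) z≤n
  ... | yes k≤n = begin
    suc n C suc k                        ≡⟨ pascal n k ⟩
    (n C k) + (n C suc k)                ≤⟨ +-mono-≤ (C≤^ n k) (C≤^ n (suc k)) ⟩
    (suc n ∸ k) ^ k + x * x ^ k          ≤⟨ +-monoʳ-≤ _ (*-monoʳ-≤ x (^-monoˡ-≤ k (∸-monoˡ-≤ k (n≤1+n n)))) ⟩
    (suc n ∸ k) ^ k + x * (suc n ∸ k) ^ k ≡⟨ cong (λ y → y * (suc n ∸ k) ^ k) (+-∸-assoc 1 k≤n) ⟨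
    (suc n ∸ k) * (suc n ∸ k) ^ k        ∎
    where
    open ≤-Reasoning
    x = n ∸ k

  -- Raising the exponent from `k` to `K` needs a positive base; when the base is 0, `k` exceeds `n`
  -- and nothing can be chosen.
  C≤^-uniform : ∀ n k rmin K → rmin ≤ suc k → k ≤ K → n C k ≤ (suc (suc n) ∸ rmin) ^ K
  C≤^-uniform n k rmin K rmin≤ k≤K with suc (suc n) ∸ rmin in eq
  ... | zero  = ≤-trans (≤-reflexive (k>n⇒nCk≡0 (s≤s⁻¹ (≤-trans (m∸n≡0⇒m≤n eq) rmin≤)))) z≤n
  ... | suc y = begin
    n C k              ≤⟨ C≤^ n k ⟩
    (suc n ∸ k) ^ k    ≤⟨ ^-monoˡ-≤ k (≤-trans (∸-monoʳ-≤ (suc (suc n)) rmin≤) (≤-reflexive eq)) ⟩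
    suc y ^ k          ≤⟨ ^-monoʳ-≤ (suc y) k≤K ⟩
    suc y ^ K          ∎
    where open ≤-Reasoning

  -- The ratios h(t + 1) / h(t) decrease weakly: at least B/A before `q`, at most B/A after it. The
  -- hypothesis allows any gap `d`, because deriving this from neighbouring values would cancel
  -- values of `h` that may be 0.
  module Tangent (h : ℕ → ℕ) (log-concave : ∀ a d → h a * h (suc (a + d)) ≤ h (suc a) * h (a + d)) (q : ℕ) where

    private
      A = h q
      B = h (suc q)

      right : ∀ d → h (q + d) * A ^ d ≤ A * B ^ d
      right zero    = ≤-reflexive (cong (λ t → h t * 1) (+-identityʳ q))
      right (suc d) = begin
        h (q + suc d) * (A * A ^ d)   ≡⟨ cong (λ t → h t * (A * A ^ d)) (+-suc q d) ⟩
        h (suc (q + d)) * (A * A ^ d) ≡⟨ regroup₁ (h (suc (q + d))) A (A ^ d) ⟩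
        A * h (suc (q + d)) * A ^ d   ≤⟨ *-monoˡ-≤ (A ^ d) (log-concave q d) ⟩
        B * h (q + d) * A ^ d         ≡⟨ *-assoc B (h (q + d)) (A ^ d) ⟩
        B * (h (q + d) * A ^ d)       ≤⟨ *-monoʳ-≤ B (right d) ⟩
        B * (A * B ^ d)               ≡⟨ regroup₂ B A (B ^ d) ⟩
        A * (B * B ^ d)               ∎
        where
        open ≤-Reasoning
        regroup₁ : ∀ x a y → x * (a * y) ≡ a * x * y
        regroup₁ = solve-∀
        regroup₂ : ∀ b a y → b * (a * y) ≡ a * (b * y)
        regroup₂ = solve-∀

      left : ∀ d t → t + d ≡ q → h t * B ^ d ≤ A * A ^ d
      left zero    t eq   = ≤-reflexive (cong (λ t → h t * 1) (trans (sym (+-identityʳ t)) eq))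
      left (suc d) t refl = begin
        h t * (B * B ^ d)           ≡⟨ *-assoc (h t) B (B ^ d) ⟨
        h t * B * B ^ d             ≤⟨ *-monoˡ-≤ (B ^ d) (log-concave t (suc d)) ⟩
        h (suc t) * A * B ^ d       ≡⟨ regroup (h (suc t)) A (B ^ d) ⟩
        A * (h (suc t) * B ^ d)     ≤⟨ *-monoʳ-≤ A (left d (suc t) (sym (+-suc t d))) ⟩
        A * (A * A ^ d)             ∎
        where
        open ≤-Reasoning
        regroup : ∀ x a y → x * a * y ≡ a * (x * y)
        regroup = solve-∀

    -- h t ≤ A (B / A) ^ (t − q), the geometric tangent at q, without division
    tangent : ∀ t → h t * A ^ t * B ^ q ≤ A * A ^ q * B ^ t
    tangent t with ≤-total q t
    ... | inj₁ q≤t = begin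
      h t * A ^ t * B ^ q                     ≡⟨ cong (λ u → h u * A ^ u * B ^ q) t≡ ⟨
      h (q + d) * A ^ (q + d) * B ^ q         ≡⟨ cong (λ y → h (q + d) * y * B ^ q) (^-distribˡ-+-* A q d) ⟩
      h (q + d) * (A ^ q * A ^ d) * B ^ q     ≡⟨ regroup₁ (h (q + d)) (A ^ q) (A ^ d) (B ^ q) ⟩
      (h (q + d) * A ^ d) * (A ^ q * B ^ q)   ≤⟨ *-monoˡ-≤ (A ^ q * B ^ q) (right d) ⟩
      (A * B ^ d) * (A ^ q * B ^ q)           ≡⟨ regroup₂ A (B ^ d) (A ^ q) (B ^ q) ⟩
      A * A ^ q * (B ^ q * B ^ d)             ≡⟨ cong (A * A ^ q *_) (^-distribˡ-+-* B q d) ⟨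
      A * A ^ q * B ^ (q + d)                 ≡⟨ cong (λ u → A * A ^ q * B ^ u) t≡ ⟩
      A * A ^ q * B ^ t                       ∎
      where
      open ≤-Reasoning
      d = t ∸ q
      t≡ : q + d ≡ t
      t≡ = m+[n∸m]≡n q≤t
      regroup₁ : ∀ x a a′ b → x * (a * a′) * b ≡ (x * a′) * (a * b)
      regroup₁ = solve-∀
      regroup₂ : ∀ a b′ a′ b → (a * b′) * (a′ * b) ≡ a * a′ * (b * b′)
      regroup₂ = solve-∀
    ... | inj₂ t≤q = begin
      h t * A ^ t * B ^ q                     ≡⟨ cong (λ u → h t * A ^ t * B ^ u) q≡ ⟨
      h t * A ^ t * B ^ (t + d)               ≡⟨ cong (h t * A ^ t *_) (^-distribˡ-+-* B t d) ⟩
      h t * A ^ t * (B ^ t * B ^ d)           ≡⟨ regroup₁ (h t) (A ^ t) (B ^ t) (B ^ d) ⟩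
      (h t * B ^ d) * (A ^ t * B ^ t)         ≤⟨ *-monoˡ-≤ (A ^ t * B ^ t) (left d t q≡) ⟩
      (A * A ^ d) * (A ^ t * B ^ t)           ≡⟨ regroup₂ A (A ^ d) (A ^ t) (B ^ t) ⟩
      A * (A ^ t * A ^ d) * B ^ t             ≡⟨ cong (λ y → A * y * B ^ t) (^-distribˡ-+-* A t d) ⟨
      A * A ^ (t + d) * B ^ t                 ≡⟨ cong (λ u → A * A ^ u * B ^ t) q≡ ⟩
      A * A ^ q * B ^ t                       ∎
      where
      open ≤-Reasoning
      d = q ∸ t
      q≡ : t + d ≡ q
      q≡ = m+[n∸m]≡n t≤q
      regroup₁ : ∀ x a b b′ → x * a * (b * b′) ≡ (x * b′) * (a * b)
      regroup₁ = solve-∀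
      regroup₂ : ∀ a a′ a″ b → (a * a′) * (a″ * b) ≡ a * (a″ * a′) * b
      regroup₂ = solve-∀

  -- With ρ = B/A, the bounds f t ≤ (c/β) ρ^t and e u ≤ (d/γ) C(u + r, r) ρ^u convolve to one of the
  -- second form with r + 1; all denominators are multiplied out.
  convolution-bound : ∀ A B r γ d e → (∀ u → e u * A ^ u * γ ≤ d * ((u + r) C r) * B ^ u) →
    ∀ β c f → (∀ t → f t * A ^ t * β ≤ c * B ^ t) →
    ∀ s → convolution f e s * A ^ s * (β * γ) ≤ c * d * ((s + suc r) C suc r) * B ^ s
  convolution-bound A B r γ d e e≤ = go
    where
    open ≤-Reasoning
    regroup₁ : ∀ x y a β γ → x * y * a * (β * γ) ≡ (x * 1 * β) * (y * a * γ)
    regroup₁ = solve-∀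
    regroup₂ : ∀ c d k b → (c * 1) * (d * k * b) ≡ c * d * k * b
    regroup₂ = solve-∀
    regroup₃ : ∀ x v a a′ β γ → (x + v) * (a * a′) * (β * γ) ≡ x * (a * a′) * (β * γ) + v * a′ * ((a * β) * γ)
    regroup₃ = solve-∀
    regroup₄ : ∀ c d k k′ b b′ → c * d * k * (b * b′) + (c * b) * d * k′ * b′ ≡ c * d * (k + k′) * (b * b′)
    regroup₄ = solve-∀

    first : ∀ β c f → (∀ t → f t * A ^ t * β ≤ c * B ^ t) → ∀ s →
      f 0 * e s * A ^ s * (β * γ) ≤ c * d * ((s + r) C r) * B ^ s
    first β c f f≤ s = begin
      f 0 * e s * A ^ s * (β * γ)                 ≡⟨ regroup₁ (f 0) (e s) (A ^ s) β γ ⟩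
      (f 0 * 1 * β) * (e s * A ^ s * γ)           ≤⟨ *-mono-≤ (f≤ 0) (e≤ s) ⟩
      (c * 1) * (d * ((s + r) C r) * B ^ s)       ≡⟨ regroup₂ c d ((s + r) C r) (B ^ s) ⟩
      c * d * ((s + r) C r) * B ^ s               ∎

    go : ∀ β c f → (∀ t → f t * A ^ t * β ≤ c * B ^ t) →
      ∀ s → convolution f e s * A ^ s * (β * γ) ≤ c * d * ((s + suc r) C suc r) * B ^ s
    go β c f f≤ zero    = begin
      f 0 * e 0 * 1 * (β * γ)                   ≤⟨ first β c f f≤ 0 ⟩
      c * d * (r C r) * 1                       ≤⟨ *-monoˡ-≤ 1 (*-monoʳ-≤ (c * d) (≤-trans (m≤m+n _ _) (≤-reflexive (sym (pascal r r))))) ⟩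
      c * d * (suc r C suc r) * 1               ∎
    go β c f f≤ (suc s) = begin
      (f 0 * e (suc s) + convolution (f ∘ suc) e s) * (A * A ^ s) * (β * γ)
        ≡⟨ regroup₃ (f 0 * e (suc s)) (convolution (f ∘ suc) e s) A (A ^ s) β γ ⟩
      f 0 * e (suc s) * (A * A ^ s) * (β * γ) + convolution (f ∘ suc) e s * A ^ s * ((A * β) * γ)
        ≤⟨ +-mono-≤ (first β c f f≤ (suc s)) (go (A * β) (c * B) (f ∘ suc) shifted s) ⟩
      c * d * ((suc s + r) C r) * (B * B ^ s) + (c * B) * d * ((s + suc r) C suc r) * B ^ s
        ≡⟨ regroup₄ c d ((suc s + r) C r) ((s + suc r) C suc r) B (B ^ s) ⟩
      c * d * (((suc s + r) C r) + ((s + suc r) C suc r)) * (B * B ^ s)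
        ≡⟨ cong (λ k → c * d * k * (B * B ^ s)) hockey-stick ⟩
      c * d * ((suc s + suc r) C suc r) * (B * B ^ s) ∎
      where
      hockey-stick : ((suc s + r) C r) + ((s + suc r) C suc r) ≡ (suc s + suc r) C suc r
      hockey-stick = trans (cong (λ n → (n C r) + ((s + suc r) C suc r)) (sym (+-suc s r))) (sym (pascal (s + suc r) r))
      -- Shifting `f` by one multiplies its constant c/β by B/A, which is why `β` and `c` vary in
      -- the induction.
      shifted : ∀ t → f (suc t) * A ^ t * (A * β) ≤ c * B * B ^ t
      shifted t = begin
        f (suc t) * A ^ t * (A * β)   ≡⟨ regroup₅ (f (suc t)) (A ^ t) A β ⟩
        f (suc t) * (A * A ^ t) * β   ≤⟨ f≤ (suc t) ⟩
        c * (B * B ^ t)               ≡⟨ *-assoc c B (B ^ t) ⟨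
        c * B * B ^ t                 ∎
        where
        regroup₅ : ∀ x y a b → x * y * (a * b) ≡ x * (a * y) * b
        regroup₅ = solve-∀

  module _ (M rmin : ℕ) where

    -- M/2 · (σ + 1) − rmin + 1 for σ = 2 t + 1, truncated at 0
    factor : ℕ → ℕ
    factor t = suc (M * suc t) ∸ rmin

    factor-mono : ∀ t → factor t ≤ factor (suc t)
    factor-mono t = ∸-monoˡ-≤ rmin (s≤s (*-monoʳ-≤ M (n≤1+n (suc t))))

    private
      -- Once positive, `factor` has left the truncated range and is affine with slope `M`.
      factor-step : ∀ t d {x} → factor t ≡ suc x → factor (t + d) ≡ suc x + M * d
      factor-step t d {x} eq = begin
        suc (M * suc (t + d)) ∸ rmin        ≡⟨ cong (λ n → suc n ∸ rmin) (*-distribˡ-+ M (suc t) d) ⟩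
        suc (M * suc t) + M * d ∸ rmin      ≡⟨ +-∸-comm {suc (M * suc t)} (M * d) {rmin} (<⇒≤ (m∸n≢0⇒n<m (λ eq′ → 1+n≢0 (trans (sym eq) eq′)))) ⟩
        factor t + M * d                    ≡⟨ cong (_+ M * d) eq ⟩
        suc x + M * d                       ∎
        where open ≡-Reasoning

    factor-log-concave : ∀ a d → factor a * factor (suc (a + d)) ≤ factor (suc a) * factor (a + d)
    factor-log-concave a d with factor a in eq
    ... | zero  = z≤n
    ... | suc x = begin
      suc x * factor (suc (a + d))            ≡⟨ cong (λ u → suc x * factor u) (+-suc a d) ⟨
      suc x * factor (a + suc d)              ≡⟨ cong (suc x *_) (factor-step a (suc d) eq) ⟩
      -- With X = `suc x`, the added term is exactly (X + M)(X + M d) - X (X + M (d + 1)).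
      suc x * (suc x + M * suc d)             ≤⟨ m≤m+n _ (M * (M * d)) ⟩
      suc x * (suc x + M * suc d) + M * (M * d) ≡⟨ expansion x M d ⟩
      (suc x + M * 1) * (suc x + M * d)       ≡⟨ cong₂ _*_ (factor-step a 1 eq) (factor-step a d eq) ⟨
      factor (a + 1) * factor (a + d)         ≡⟨ cong (λ u → factor u * factor (a + d)) (+-comm a 1) ⟩
      factor (suc a) * factor (a + d)         ∎
      where
      open ≤-Reasoning
      expansion : ∀ x M d → suc x * (suc x + M * suc d) + M * (M * d) ≡ (suc x + M * 1) * (suc x + M * d)
      expansion = solve-∀

    placements-vanishes : ∀ k t → rmin ≤ suc k → factor t ≡ 0 → placements M k t ≡ 0
    placements-vanishes = vanishes M refl
      where
      -- `M` is split because the subtraction of 1 computes only for positive `M`; for `M` = 0 the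
      -- leading factor is 0.
      vanishes : ∀ M′ → M′ ≡ M → ∀ k t → rmin ≤ suc k → factor t ≡ 0 → placements M′ k t ≡ 0
      vanishes zero     _    k t rmin≤ eq = refl
      vanishes (suc M′) refl k t rmin≤ eq = trans
        (cong (suc M′ *_) (k>n⇒nCk≡0 (s≤s⁻¹ (≤-trans (m∸n≡0⇒m≤n eq) rmin≤)))) (*-zeroʳ (suc M′))

    placements≤ : ∀ K k t → rmin ≤ suc k → k ≤ K → placements M k t ≤ M * factor t ^ K
    placements≤ = bounded M refl
      where
      bounded : ∀ M′ → M′ ≡ M → ∀ K k t → rmin ≤ suc k → k ≤ K → placements M′ k t ≤ M′ * factor t ^ K
      bounded zero     _    K k t rmin≤ k≤K = z≤n
      bounded (suc M′) refl K k t rmin≤ k≤K = *-monoʳ-≤ (suc M′) (C≤^-uniform (t + M′ * suc t) k rmin K rmin≤ k≤K)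

  product-zero : ∀ {x y} → x ≡ 0 ⊎ y ≡ 0 → x * y ≡ 0
  product-zero         (inj₁ refl) = refl
  product-zero {x = x} (inj₂ refl) = *-zeroʳ x

  convolution-vanishes : ∀ e s f → (∀ i j → i + j ≡ s → f i ≡ 0 ⊎ e j ≡ 0) → convolution f e s ≡ 0
  convolution-vanishes e zero    f zeros = product-zero (zeros 0 0 refl)
  convolution-vanishes e (suc s) f zeros = cong₂ _+_ (product-zero (zeros 0 (suc s) refl))
    (convolution-vanishes e s (f ∘ suc) (λ i j eq → zeros (suc i) j (cong suc eq)))

  module _ (M rmin K : ℕ) where

    FitsBetween : ℕ → Set
    FitsBetween k = rmin ≤ suc k × k ≤ K

    -- Pigeonhole: `length ks` parts with sum at most `s` cannot all exceed `q`, and by monotonicity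
    -- `factor` is 0 at every part up to `q`.
    profiles-vanishes : ∀ q → factor M rmin q ≡ 0 → ∀ ks → All FitsBetween ks →
      ∀ s → s < length ks * suc q → profiles M ks s ≡ 0
    profiles-vanishes q eq []       fits                 s ()
    profiles-vanishes q eq (k ∷ ks) ((rmin≤ , _) ∷ fits) s s<  =
      convolution-vanishes (profiles M ks) s (placements M k) zeros
      where
      factor≤ : ∀ {i q} → i ≤′ q → factor M rmin q ≡ 0 → factor M rmin i ≡ 0
      factor≤ ≤′-refl            q≡0 = q≡0
      factor≤ (≤′-step {q′} i≤q) q≡0 =
        factor≤ i≤q (n≤0⇒n≡0 (≤-trans (factor-mono M rmin q′) (≤-reflexive q≡0)))
      zeros : ∀ i j → i + j ≡ s → placements M k i ≡ 0 ⊎ profiles M ks j ≡ 0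
      zeros i j refl with i ≤? q
      ... | yes i≤q = inj₁ (placements-vanishes M rmin k i rmin≤ (factor≤ (≤⇒≤′ i≤q) eq))
      ... | no  i≰q = inj₂ (profiles-vanishes q eq ks fits j
        (+-cancelˡ-< (suc q) j _ (≤-<-trans (+-monoˡ-≤ j (≰⇒> i≰q)) s<)))

    private
      h : ℕ → ℕ
      h t = factor M rmin t ^ K

      h-log-concave : ∀ a d → h a * h (suc (a + d)) ≤ h (suc a) * h (a + d)
      h-log-concave a d = subst₂ _≤_ (^-distribʳ-* _ _ K) (^-distribʳ-* _ _ K)
        (^-monoˡ-≤ K (factor-log-concave M rmin a d))

    module _ (q : ℕ) where

      private
        A = h q
        B = h (suc q)

      profiles-tangent : ∀ ks → All FitsBetween ks → ∀ s → let r = length ks in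
        profiles M ks s * A ^ s * (B ^ q) ^ r ≤ (M * (A * A ^ q)) ^ r * ((s + r) C r) * B ^ s
      profiles-tangent []       []                     s = begin
        1 * A ^ s * 1   ≡⟨ *-identityʳ _ ⟩
        -- Here A ≤ B pays for the amount by which the profile falls short of `s`.
        1 * A ^ s       ≤⟨ *-monoʳ-≤ 1 (^-monoˡ-≤ s (^-monoˡ-≤ K (factor-mono M rmin q))) ⟩
        1 * B ^ s       ∎
        where open ≤-Reasoning
      profiles-tangent (k ∷ ks) ((rmin≤ , k≤K) ∷ fits) s =
        convolution-bound A B (length ks) ((B ^ q) ^ length ks) ((M * (A * A ^ q)) ^ length ks) (profiles M ks)
          (profiles-tangent ks fits) (B ^ q) (M * (A * A ^ q)) (placements M k) bounded s
        where
        open ≤-Reasoning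
        bounded : ∀ t → placements M k t * A ^ t * B ^ q ≤ M * (A * A ^ q) * B ^ t
        bounded t = begin
          placements M k t * A ^ t * B ^ q   ≤⟨ *-monoˡ-≤ _ (*-monoˡ-≤ _ (placements≤ M rmin K k t rmin≤ k≤K)) ⟩
          M * h t * A ^ t * B ^ q            ≡⟨ regroup M (h t) (A ^ t) (B ^ q) ⟩
          M * (h t * A ^ t * B ^ q)          ≤⟨ *-monoʳ-≤ M (Tangent.tangent h h-log-concave q t) ⟩
          M * (A * A ^ q * B ^ t)            ≡⟨ *-assoc M (A * A ^ q) (B ^ t) ⟨
          M * (A * A ^ q) * B ^ t            ∎
          where
          regroup : ∀ m x a b → m * x * a * b ≡ m * (x * a * b)
          regroup = solve-∀

      -- Dividing `profiles-tangent` by A^s B^(q r) leaves M^r A^(r - m) B^m, since s = q r + m. A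
      -- nonzero `factor` at `q` makes the division possible.
      profiles-balanced : .{{_ : NonZero (factor M rmin q)}} → ∀ ks → All FitsBetween ks →
        ∀ s m m′ → m + m′ ≡ length ks → s ≡ q * length ks + m →
        profiles M ks s ≤ ((s + length ks) C length ks) * ((M * B) ^ m * (M * A) ^ m′)
      profiles-balanced ks fits s m m′ m+m′≡r s≡ =
        *-cancelʳ-≤ _ _ X {{m*n≢0 (A ^ s) ((B ^ q) ^ r) {{m^n≢0 A s}} {{m^n≢0 (B ^ q) r {{m^n≢0 B q}}}}}} (begin
          profiles M ks s * X
            ≡⟨ *-assoc (profiles M ks s) (A ^ s) ((B ^ q) ^ r) ⟨
          profiles M ks s * A ^ s * (B ^ q) ^ r
            ≤⟨ profiles-tangent ks fits s ⟩
          (M * (A * A ^ q)) ^ r * c * B ^ s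
            ≡⟨ rebalance ⟩
          c * ((M * B) ^ m * (M * A) ^ m′) * X ∎)
        where
        open ≤-Reasoning
        r = length ks
        c = (s + r) C r
        X = A ^ s * (B ^ q) ^ r
        instance
          A≢0 : NonZero A
          A≢0 = m^n≢0 (factor M rmin q) K
          B≢0 : NonZero B
          B≢0 = >-nonZero (<-≤-trans (>-nonZero⁻¹ A) (^-monoˡ-≤ K (factor-mono M rmin q)))
        power-split : ∀ x → x ^ r ≡ x ^ m * x ^ m′
        power-split x = trans (cong (x ^_) (sym m+m′≡r)) (^-distribˡ-+-* x m m′)
        power-s : ∀ x → x ^ s ≡ (x ^ q) ^ r * x ^ m
        power-s x = trans (cong (x ^_) s≡) (trans (^-distribˡ-+-* x (q * r) m) (cong (_* x ^ m) (sym (^-*-assoc x q r))))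
        rebalance : (M * (A * A ^ q)) ^ r * c * B ^ s ≡ c * ((M * B) ^ m * (M * A) ^ m′) * X
        rebalance rewrite ^-distribʳ-* M (A * A ^ q) r | ^-distribʳ-* A (A ^ q) r
          | ^-distribʳ-* M B m | ^-distribʳ-* M A m′ | power-s A | power-s B
          | power-split M | power-split A =
          regroup (M ^ m) (M ^ m′) (A ^ m) (A ^ m′) ((A ^ q) ^ r) c ((B ^ q) ^ r) (B ^ m)
          where
          regroup : ∀ M₁ M₂ A₁ A₂ A₃ c B₁ B₂ →
            (M₁ * M₂) * ((A₁ * A₂) * A₃) * c * (B₁ * B₂) ≡
            c * ((M₁ * B₂) * (M₂ * A₂)) * ((A₃ * A₁) * B₁)
          regroup = solve-∀

-- Integers inside the rationals; values of `floor`, `E≤`, `O≤` and `binom`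

module RationalBound where

  open import Defs using (Odd; IsLargestBelow; O≤; E≤; O≤-isLargest; E≤-isLargest; fromℕ; binom)
  import Data.Rational.Properties as ℚ
  open import Algebra.Definitions.RawSemiring ℚ.+-*-rawSemiring using (_^_)
  open import Data.Integer as ℤ using (ℤ; +_; -[1+_]; +≤+)
  import Data.Integer.DivMod as ℤ
  import Data.Integer.Properties as ℤ
  open import Data.Nat as ℕ using (ℕ; zero; suc; NonZero)
  open import Data.Nat.Combinatorics using (_C_; k>n⇒nCk≡0)
  import Data.Nat.DivMod as ℕ
  import Data.Nat.Properties as ℕ
  open import Data.Nat.Tactic.RingSolver using (solve-∀)
  open import Data.Product using (_,_; ∃-syntax)
  open import Data.Rational as ℚ using (ℚ; 0ℚ; toℚᵘ; floor)
  open import Data.Rational.Literals using (fromℤ)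
  open import Data.Rational.Unnormalised as ℚᵘ using (mkℚᵘ; *≡*; *≤*)
  import Data.Rational.Unnormalised.Properties as ℚᵘ
  open import Relation.Binary.PropositionalEquality
  open import Relation.Nullary using (contradiction)

  fromℤ-+ : ∀ i j → fromℤ i ℚ.+ fromℤ j ≡ fromℤ (i ℤ.+ j)
  fromℤ-+ i j = ℚ.toℚᵘ-injective (ℚᵘ.≃-trans (ℚ.toℚᵘ-homo-+ (fromℤ i) (fromℤ j))
    (*≡* (cong (ℤ._* + 1) (cong₂ ℤ._+_ (ℤ.*-identityʳ i) (ℤ.*-identityʳ j)))))

  fromℤ-* : ∀ i j → fromℤ i ℚ.* fromℤ j ≡ fromℤ (i ℤ.* j)
  fromℤ-* i j = ℚ.toℚᵘ-injective (ℚᵘ.≃-trans (ℚ.toℚᵘ-homo-* (fromℤ i) (fromℤ j)) (*≡* refl))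

  fromℤ-neg : ∀ i → ℚ.- fromℤ i ≡ fromℤ (ℤ.- i)
  fromℤ-neg i = ℚ.toℚᵘ-injective (ℚᵘ.≃-trans (ℚ.toℚᵘ-homo‿- (fromℤ i)) (*≡* refl))

  fromℕ-* : ∀ m n → fromℕ m ℚ.* fromℕ n ≡ fromℕ (m ℕ.* n)
  fromℕ-* m n = trans (fromℤ-* (+ m) (+ n)) (cong fromℤ (sym (ℤ.pos-* m n)))

  fromℕ-^ : ∀ m k → fromℕ m ^ k ≡ fromℕ (m ℕ.^ k)
  fromℕ-^ m zero    = refl
  fromℕ-^ m (suc k) = trans (cong (fromℕ m ℚ.*_) (fromℕ-^ m k)) (fromℕ-* m (m ℕ.^ k))

  fromℕ-mono-≤ : ∀ {m n} → m ℕ.≤ n → fromℕ m ℚ.≤ fromℕ n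
  fromℕ-mono-≤ m≤n = ℚ.*≤* (ℤ.*-monoʳ-≤-nonNeg (+ 1) (+≤+ m≤n))

  fromℕ-cancel-≤ : ∀ {m n} → fromℕ m ℚ.≤ fromℕ n → m ℕ.≤ n
  fromℕ-cancel-≤ {m} {n} (ℚ.*≤* le) = ℤ.drop‿+≤+ (ℤ.*-cancelʳ-≤-pos (+ m) (+ n) (+ 1) le)

  /-toℚᵘ : ∀ i d → toℚᵘ (i ℚ./ suc d) ℚᵘ.≃ mkℚᵘ i d
  /-toℚᵘ i d = ℚ.toℚᵘ-fromℚᵘ (mkℚᵘ i d)

  fromℤ≤/⁺ : ∀ k i d → k ℤ.* + suc d ℤ.≤ i → fromℤ k ℚ.≤ i ℚ./ suc d
  fromℤ≤/⁺ k i d k≤ = ℚ.toℚᵘ-cancel-≤ (ℚᵘ.≤-trans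
    (*≤* (subst (k ℤ.* + suc d ℤ.≤_) (sym (ℤ.*-identityʳ i)) k≤)) (ℚᵘ.≤-reflexive (ℚᵘ.≃-sym (/-toℚᵘ i d))))

  fromℤ≤/⁻ : ∀ k i d → fromℤ k ℚ.≤ i ℚ./ suc d → k ℤ.* + suc d ℤ.≤ i
  fromℤ≤/⁻ k i d k≤ with ℚᵘ.≤-trans (ℚ.toℚᵘ-mono-≤ k≤) (ℚᵘ.≤-reflexive (/-toℚᵘ i d))
  ... | *≤* le = subst (k ℤ.* + suc d ℤ.≤_) (ℤ.*-identityʳ i) le

  floor-fromℕ : ∀ n → floor (fromℕ n) ≡ + n
  floor-fromℕ n = trans (ℤ.div-pos-is-/ℕ (+ n) 1) (cong +_ (ℕ.n/1≡n n))

  half-double : ∀ n → (+ (n ℕ.+ n)) ℚ./ 2 ≡ fromℕ n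
  half-double n = ℚ.toℚᵘ-injective (ℚᵘ.≃-trans (/-toℚᵘ (+ (n ℕ.+ n)) 1) (*≡* (begin
    + (n ℕ.+ n) ℤ.* + 1   ≡⟨ ℤ.pos-* (n ℕ.+ n) 1 ⟨
    + ((n ℕ.+ n) ℕ.* 1)   ≡⟨ cong +_ (double n) ⟩
    + (n ℕ.* 2)           ≡⟨ ℤ.pos-* n 2 ⟩
    + n ℤ.* + 2           ∎)))
    where
    open ≡-Reasoning
    double : ∀ n → (n ℕ.+ n) ℕ.* 1 ≡ n ℕ.* 2
    double = solve-∀

  half+half : ∀ M → (+ M ℚ./ 2) ℚ.+ (+ M ℚ./ 2) ≡ fromℕ M
  half+half M = ℚ.toℚᵘ-injective (ℚᵘ.≃-trans (ℚ.toℚᵘ-homo-+ (+ M ℚ./ 2) (+ M ℚ./ 2))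
    (ℚᵘ.≃-trans (ℚᵘ.+-cong (/-toℚᵘ (+ M) 1) (/-toℚᵘ (+ M) 1)) (*≡* (quarter (+ M)))))
    where
    quarter : ∀ i → (i ℤ.* + 2 ℤ.+ i ℤ.* + 2) ℤ.* + 1 ≡ i ℤ.* + 4
    quarter i = trans (ℤ.*-identityʳ _) (sym (ℤ.*-distribˡ-+ i (+ 2) (+ 2)))

  [m+n]-n : ∀ m n → + (m ℕ.+ n) ℤ.- + n ≡ + m
  [m+n]-n m n = begin
    + (m ℕ.+ n) ℤ.- + n       ≡⟨ cong (ℤ._- + n) (ℤ.pos-+ m n) ⟩
    + m ℤ.+ + n ℤ.- + n       ≡⟨ ℤ.+-assoc (+ m) (+ n) (ℤ.- + n) ⟩
    + m ℤ.+ (+ n ℤ.- + n)     ≡⟨ cong (λ i → + m ℤ.+ i) (ℤ.+-inverseʳ (+ n)) ⟩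
    + m ℤ.+ + 0               ≡⟨ ℤ.+-identityʳ (+ m) ⟩
    + m                       ∎
    where open ≡-Reasoning

  floor-half : ∀ s r → floor ((+ (s ℕ.+ s ℕ.+ r) ℤ.- + r) ℚ./ 2) ≡ + s
  floor-half s r = trans (cong floor (trans (cong (λ i → i ℚ./ 2) ([m+n]-n (s ℕ.+ s) r)) (half-double s))) (floor-fromℕ s)

  E≤-even : ∀ m → E≤ (fromℕ (m ℕ.+ m)) ≡ + (m ℕ.+ m)
  E≤-even m = begin
    + 2 ℤ.* (floor (fromℕ (m ℕ.+ m)) ℤ./ + 2)  ≡⟨ cong (λ i → + 2 ℤ.* (i ℤ./ + 2)) (floor-fromℕ (m ℕ.+ m)) ⟩
    + 2 ℤ.* (+ (m ℕ.+ m) ℤ./ + 2)              ≡⟨ cong (+ 2 ℤ.*_) (ℤ.div-pos-is-/ℕ (+ (m ℕ.+ m)) 2) ⟩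
    + 2 ℤ.* + ((m ℕ.+ m) ℕ./ 2)                ≡⟨ cong (λ n → + 2 ℤ.* + (n ℕ./ 2)) (double m) ⟩
    + 2 ℤ.* + ((m ℕ.* 2) ℕ./ 2)                ≡⟨ cong (λ n → + 2 ℤ.* + n) (ℕ.m*n/n≡m m 2) ⟩
    + 2 ℤ.* + m                                ≡⟨ ℤ.pos-* 2 m ⟨
    + (2 ℕ.* m)                                ≡⟨ cong +_ (double′ m) ⟩
    + (m ℕ.+ m)                                ∎
    where
    open ≡-Reasoning
    double : ∀ n → n ℕ.+ n ≡ n ℕ.* 2
    double = solve-∀
    double′ : ∀ n → 2 ℕ.* n ≡ n ℕ.+ n
    double′ = solve-∀

  -- `E≤ x` is at most `x`, and it would be nonnegative if the floor were.
  floor-negative : ∀ x → x ℚ.< 0ℚ → ∃[ k ] floor x ≡ -[1+ k ]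
  floor-negative x x<0 with floor x | E≤-isLargest x
  ... | -[1+ k ] | _             = k , refl
  ... | + k      | (_ , E≤x , _) = contradiction (ℚ.≤-<-trans (ℚ.≤-trans 0≤E E≤x) x<0) (ℚ.<-irrefl refl)
    where
    E≡ : + 2 ℤ.* (+ k ℤ./ + 2) ≡ + (2 ℕ.* (k ℕ./ 2))
    E≡ = trans (cong (+ 2 ℤ.*_) (ℤ.div-pos-is-/ℕ (+ k) 2)) (sym (ℤ.pos-* 2 (k ℕ./ 2)))
    0≤E : fromℤ (+ 0) ℚ.≤ fromℤ (+ 2 ℤ.* (+ k ℤ./ + 2))
    0≤E = subst (λ i → fromℤ (+ 0) ℚ.≤ fromℤ i) (sym E≡) (fromℕ-mono-≤ ℕ.z≤n)

  -- The upper index is less than `r`: if natural, the binomial coefficient vanishes; if negative,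
  -- `binom` is 0 by definition.
  binom-⊖-vanishes : ∀ a k r → a ℕ.≤ r → binom (a ℤ.⊖ suc k) r ≡ 0
  binom-⊖-vanishes zero    k       r a≤r = refl
  binom-⊖-vanishes (suc a) zero    r a<r = trans (cong (λ i → binom i r) (ℤ.[1+m]⊖[1+n]≡m⊖n a 0)) (k>n⇒nCk≡0 a<r)
  binom-⊖-vanishes (suc a) (suc k) r a<r =
    trans (cong (λ i → binom i r) (ℤ.[1+m]⊖[1+n]≡m⊖n a (suc k))) (binom-⊖-vanishes a k r (ℕ.<⇒≤ a<r))

  module _ (r : ℕ) .{{nz : NonZero r}} where

    fromℤ≤R/r⁺ : ∀ k i → k ℤ.* + r ℤ.≤ i → fromℤ k ℚ.≤ (i ℚ./ r) {{nz}}
    fromℤ≤R/r⁺ = go r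
      where
      go : ∀ r .{{nz : NonZero r}} k i → k ℤ.* + r ℤ.≤ i → fromℤ k ℚ.≤ (i ℚ./ r) {{nz}}
      go (suc d) k i = fromℤ≤/⁺ k i d

    fromℤ≤R/r⁻ : ∀ k i → fromℤ k ℚ.≤ (i ℚ./ r) {{nz}} → k ℤ.* + r ℤ.≤ i
    fromℤ≤R/r⁻ = go r
      where
      go : ∀ r .{{nz : NonZero r}} k i → fromℤ k ℚ.≤ (i ℚ./ r) {{nz}} → k ℤ.* + r ℤ.≤ i
      go (suc d) k i = fromℤ≤/⁻ k i d

    -- R / r = 2 q + 1 + 2 m / r is at least 2 q + 1 and less than 2 q + 3. The value follows from
    -- the maximality of `O≤`, without evaluating `floor`.
    O≤-quotient : ∀ R q m → m ℕ.< r → R ≡ q ℕ.* r ℕ.+ m ℕ.+ (q ℕ.* r ℕ.+ m) ℕ.+ r →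
      O≤ ((+ R ℚ./ r) {{nz}}) ≡ + suc (q ℕ.+ q)
    O≤-quotient R q m m<r R≡ = unique (O≤ x) (O≤-isLargest x)
      where

      x = (+ R ℚ./ r) {{nz}}

      odd-pos : ∀ j → + 2 ℤ.* + j ℤ.+ + 1 ≡ + suc (j ℕ.+ j)
      odd-pos j = begin
        + 2 ℤ.* + j ℤ.+ + 1     ≡⟨ cong (ℤ._+ + 1) (ℤ.pos-* 2 j) ⟨
        + (2 ℕ.* j) ℤ.+ + 1     ≡⟨ ℤ.pos-+ (2 ℕ.* j) 1 ⟨
        + (2 ℕ.* j ℕ.+ 1)       ≡⟨ cong +_ (reorder j) ⟩
        + suc (j ℕ.+ j)         ∎
        where
        open ≡-Reasoning
        reorder : ∀ j → 2 ℕ.* j ℕ.+ 1 ≡ suc (j ℕ.+ j)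
        reorder = solve-∀

      lower : suc (q ℕ.+ q) ℕ.* r ℕ.≤ R
      lower = ℕ.≤-trans (ℕ.m≤m+n _ (m ℕ.+ m)) (ℕ.≤-reflexive (trans (expansion q r m) (sym R≡)))
        where
        expansion : ∀ q r m → suc (q ℕ.+ q) ℕ.* r ℕ.+ (m ℕ.+ m) ≡ q ℕ.* r ℕ.+ m ℕ.+ (q ℕ.* r ℕ.+ m) ℕ.+ r
        expansion = solve-∀

      upper : R ℕ.< suc (suc q ℕ.+ suc q) ℕ.* r
      upper = ℕ.≤-trans (ℕ.≤-reflexive (cong suc R≡)) (ℕ.≤-trans (ℕ.+-monoˡ-≤ r (ℕ.+-mono-<-≤ (ℕ.+-monoʳ-< (q ℕ.* r) m<r) (ℕ.+-monoʳ-≤ (q ℕ.* r) (ℕ.<⇒≤ m<r))))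
        (ℕ.≤-reflexive (expansion q r)))
        where
        expansion : ∀ q r → q ℕ.* r ℕ.+ r ℕ.+ (q ℕ.* r ℕ.+ r) ℕ.+ r ≡ suc (suc q ℕ.+ suc q) ℕ.* r
        expansion = solve-∀

      odd-q≤x : fromℤ (+ 2 ℤ.* + q ℤ.+ + 1) ℚ.≤ x
      odd-q≤x = fromℤ≤R/r⁺ (+ 2 ℤ.* + q ℤ.+ + 1) (+ R)
        (subst (λ i → i ℤ.* + r ℤ.≤ + R) (sym (odd-pos q))
          (subst (ℤ._≤ + R) (ℤ.pos-* (suc (q ℕ.+ q)) r) (+≤+ lower)))

      unsuc : ∀ i → i ℤ.+ + 1 ℤ.+ -[1+ 0 ] ≡ i
      unsuc i = trans (ℤ.+-assoc i (+ 1) -[1+ 0 ]) (ℤ.+-identityʳ i)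

      halve : ∀ k → + 2 ℤ.* + q ℤ.+ + 1 ℤ.≤ + 2 ℤ.* k ℤ.+ + 1 → + q ℤ.≤ k
      halve k le = ℤ.*-cancelˡ-≤-pos (+ q) k (+ 2)
        (subst₂ ℤ._≤_ (unsuc (+ 2 ℤ.* + q)) (unsuc (+ 2 ℤ.* k)) (ℤ.+-monoˡ-≤ -[1+ 0 ] le))

      -- From `+ q` upwards `k` is a natural number, so a single clause remains.
      odd : ∀ k → + q ℤ.≤ k → fromℤ (+ 2 ℤ.* k ℤ.+ + 1) ℚ.≤ x → + 2 ℤ.* k ℤ.+ + 1 ≡ + suc (q ℕ.+ q)
      odd (+ j) q≤j odd≤x = trans (odd-pos j) (cong (λ j → + suc (j ℕ.+ j)) (ℕ.≤-antisym j≤q (ℤ.drop‿+≤+ q≤j)))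
        where
        below : suc (j ℕ.+ j) ℕ.* r ℕ.≤ R
        below = ℤ.drop‿+≤+ (subst (ℤ._≤ + R) (sym (ℤ.pos-* (suc (j ℕ.+ j)) r))
          (subst (λ i → i ℤ.* + r ℤ.≤ + R) (odd-pos j) (fromℤ≤R/r⁻ (+ 2 ℤ.* + j ℤ.+ + 1) (+ R) odd≤x)))
        j≤q : j ℕ.≤ q
        j≤q = ℕ.≮⇒≥ λ q<j → ℕ.<⇒≱ upper
          (ℕ.≤-trans (ℕ.*-monoˡ-≤ r (ℕ.s≤s (ℕ.+-mono-≤ q<j q<j))) below)

      unique : ∀ o → IsLargestBelow Odd x o → o ≡ + suc (q ℕ.+ q)
      unique _ ((k , refl) , odd≤x , largest) = odd k (halve k (largest _ (+ q , refl) odd-q≤x)) odd≤x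

-- Evaluating the bound at 2 (q r + m) + r runs

module BoundValue where

  open Balance using (factor)
  open RationalBound
  open import Defs using (O≤; E≤; fromℕ; σ; binom; bound)
  import Data.Rational.Properties as ℚ
  open import Algebra.Definitions.RawSemiring ℚ.+-*-rawSemiring using (_^_; product)
  open import Data.Bool using (true; false; if_then_else_)
  open import Data.Fin as Fin using (Fin; toℕ)
  open import Data.Integer as ℤ using (ℤ; +_; -[1+_])
  import Data.Integer.Properties as ℤ
  open import Data.Nat as ℕ using (ℕ; zero; suc; _∸_; NonZero; _<ᵇ_)
  open import Data.Nat.Combinatorics using (_C_)
  import Data.Nat.Properties as ℕ
  open import Data.Nat.Tactic.RingSolver using (solve-∀)
  open import Data.Product using (_,_; ∃-syntax)
  open import Data.Rational as ℚ using (ℚ; 0ℚ; 1ℚ; ½; floor)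
  open import Data.Rational.Literals using (fromℤ)
  open import Function using (_∘_; mk⇔)
  open import Relation.Binary.PropositionalEquality
  open import Relation.Nullary using (does)
  open import Relation.Nullary.Decidable using (does-⇔)

  ½*double : ∀ m → ½ ℚ.* fromℕ (m ℕ.+ m) ≡ fromℕ m
  ½*double m = begin
    ½ ℚ.* fromℕ (m ℕ.+ m)                   ≡⟨ cong (½ ℚ.*_) (fromℤ-+ (+ m) (+ m)) ⟨
    ½ ℚ.* (fromℕ m ℚ.+ fromℕ m)             ≡⟨ ℚ.*-distribˡ-+ ½ (fromℕ m) (fromℕ m) ⟩
    ½ ℚ.* fromℕ m ℚ.+ ½ ℚ.* fromℕ m         ≡⟨ ℚ.*-distribʳ-+ (fromℕ m) ½ ½ ⟨
    (½ ℚ.+ ½) ℚ.* fromℕ m                   ≡⟨ ℚ.*-identityˡ (fromℕ m) ⟩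
    fromℕ m                                 ∎
    where open ≡-Reasoning

  /2-double : ∀ M n → (+ M ℚ./ 2) ℚ.* fromℕ (n ℕ.+ n) ≡ fromℕ (M ℕ.* n)
  /2-double M n = begin
    (+ M ℚ./ 2) ℚ.* fromℕ (n ℕ.+ n)                   ≡⟨ cong ((+ M ℚ./ 2) ℚ.*_) (fromℤ-+ (+ n) (+ n)) ⟨
    (+ M ℚ./ 2) ℚ.* (fromℕ n ℚ.+ fromℕ n)             ≡⟨ ℚ.*-distribˡ-+ (+ M ℚ./ 2) (fromℕ n) (fromℕ n) ⟩
    (+ M ℚ./ 2) ℚ.* fromℕ n ℚ.+ (+ M ℚ./ 2) ℚ.* fromℕ n ≡⟨ ℚ.*-distribʳ-+ (fromℕ n) (+ M ℚ./ 2) (+ M ℚ./ 2) ⟨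
    ((+ M ℚ./ 2) ℚ.+ (+ M ℚ./ 2)) ℚ.* fromℕ n         ≡⟨ cong (ℚ._* fromℕ n) (half+half M) ⟩
    fromℕ M ℚ.* fromℕ n                               ≡⟨ fromℕ-* M n ⟩
    fromℕ (M ℕ.* n)                                   ∎
    where open ≡-Reasoning

  ∸-fromℤ : ∀ m n → n ℕ.≤ m → + m ℤ.+ ℤ.- + n ℤ.+ + 1 ≡ + (suc m ∸ n)
  ∸-fromℤ m n n≤m = begin
    + m ℤ.+ ℤ.- + n ℤ.+ + 1           ≡⟨ cong (λ k → + k ℤ.+ ℤ.- + n ℤ.+ + 1) (ℕ.m∸n+n≡m n≤m) ⟨
    + (m ∸ n ℕ.+ n) ℤ.- + n ℤ.+ + 1   ≡⟨ cong (ℤ._+ + 1) ([m+n]-n (m ∸ n) n) ⟩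
    + (m ∸ n) ℤ.+ + 1                 ≡⟨ ℤ.+-comm (+ (m ∸ n)) (+ 1) ⟩
    + suc (m ∸ n)                     ≡⟨ cong +_ (ℕ.+-∸-assoc 1 n≤m) ⟨
    + (suc m ∸ n)                     ∎
    where open ≡-Reasoning

  -- A nonzero truncated difference has not been truncated, so it agrees with the rational one.
  factor-fromℕ : ∀ M rmin t .{{_ : NonZero (factor M rmin t)}} →
    (+ M ℚ./ 2) ℚ.* (fromℕ (suc (t ℕ.+ t)) ℚ.+ 1ℚ) ℚ.- fromℕ rmin ℚ.+ 1ℚ ≡ fromℕ (factor M rmin t)
  factor-fromℕ M rmin t {{nz}} = begin
    (+ M ℚ./ 2) ℚ.* (fromℕ (suc (t ℕ.+ t)) ℚ.+ 1ℚ) ℚ.- fromℕ rmin ℚ.+ 1ℚ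
      ≡⟨ cong (λ y → (+ M ℚ./ 2) ℚ.* y ℚ.- fromℕ rmin ℚ.+ 1ℚ)
           (trans (fromℤ-+ (+ suc (t ℕ.+ t)) (+ 1)) (cong fromℕ (even t))) ⟩
    (+ M ℚ./ 2) ℚ.* fromℕ (suc t ℕ.+ suc t) ℚ.- fromℕ rmin ℚ.+ 1ℚ
      ≡⟨ cong (λ y → y ℚ.- fromℕ rmin ℚ.+ 1ℚ) (/2-double M (suc t)) ⟩
    fromℕ (M ℕ.* suc t) ℚ.- fromℕ rmin ℚ.+ 1ℚ
      ≡⟨ cong (λ y → fromℕ (M ℕ.* suc t) ℚ.+ y ℚ.+ 1ℚ) (fromℤ-neg (+ rmin)) ⟩
    fromℕ (M ℕ.* suc t) ℚ.+ fromℤ (ℤ.- + rmin) ℚ.+ 1ℚ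
      ≡⟨ cong (ℚ._+ 1ℚ) (fromℤ-+ (+ (M ℕ.* suc t)) (ℤ.- + rmin)) ⟩
    fromℤ (+ (M ℕ.* suc t) ℤ.+ ℤ.- + rmin) ℚ.+ 1ℚ
      ≡⟨ fromℤ-+ (+ (M ℕ.* suc t) ℤ.+ ℤ.- + rmin) (+ 1) ⟩
    fromℤ (+ (M ℕ.* suc t) ℤ.+ ℤ.- + rmin ℤ.+ + 1)
      ≡⟨ cong fromℤ (∸-fromℤ (M ℕ.* suc t) rmin rmin≤) ⟩
    fromℕ (factor M rmin t) ∎
    where
    open ≡-Reasoning
    even : ∀ t → suc (t ℕ.+ t) ℕ.+ 1 ≡ suc t ℕ.+ suc t
    even = solve-∀
    rmin≤ : rmin ℕ.≤ M ℕ.* suc t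
    rmin≤ = ℕ.s≤s⁻¹ (ℕ.m∸n≢0⇒n<m (ℕ.≢-nonZero⁻¹ (factor M rmin t) {{nz}}))

  -- The excess R - r (2 q + 1) is 2 m, so the threshold is `m`. As `j` counts from 0, `suc j ≤ m`
  -- becomes `j <ᵇ m`.
  σ-balanced : ∀ r .{{nz : NonZero r}} R q m → m ℕ.< r → R ≡ q ℕ.* r ℕ.+ m ℕ.+ (q ℕ.* r ℕ.+ m) ℕ.+ r →
    ∀ j → σ r R {{nz}} (suc j) ≡ (if j <ᵇ m then + suc (suc q ℕ.+ suc q) else + suc (q ℕ.+ q))
  σ-balanced r {{nz}} R q m m<r R≡ j = go (O≤ ((+ R ℚ./ r) {{nz}})) (O≤-quotient r {{nz}} R q m m<r R≡)
    where
    o = + suc (q ℕ.+ q)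

    excess : + R ℤ.- + r ℤ.* o ≡ + (m ℕ.+ m)
    excess = begin
      + R ℤ.- + r ℤ.* o
        ≡⟨ cong (λ i → + R ℤ.- i) (ℤ.pos-* r (suc (q ℕ.+ q))) ⟨
      + R ℤ.- + (r ℕ.* suc (q ℕ.+ q))
        ≡⟨ cong (λ n → + n ℤ.- + (r ℕ.* suc (q ℕ.+ q))) (trans R≡ (expansion q r m)) ⟩
      + (m ℕ.+ m ℕ.+ r ℕ.* suc (q ℕ.+ q)) ℤ.- + (r ℕ.* suc (q ℕ.+ q))
        ≡⟨ [m+n]-n (m ℕ.+ m) (r ℕ.* suc (q ℕ.+ q)) ⟩
      + (m ℕ.+ m) ∎
      where
      open ≡-Reasoning
      expansion : ∀ q r m → q ℕ.* r ℕ.+ m ℕ.+ (q ℕ.* r ℕ.+ m) ℕ.+ r ≡ m ℕ.+ m ℕ.+ r ℕ.* suc (q ℕ.+ q)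
      expansion = solve-∀

    threshold : ½ ℚ.* fromℤ (E≤ (fromℤ (+ R ℤ.- + r ℤ.* o))) ≡ fromℕ m
    threshold = trans (cong (λ i → ½ ℚ.* fromℤ (E≤ (fromℤ i))) excess)
                  (trans (cong (λ i → ½ ℚ.* fromℤ i) (E≤-even m)) (½*double m))

    below : does (fromℕ (suc j) ℚ.≤? fromℕ m) ≡ (j <ᵇ m)
    below = does-⇔ (mk⇔ fromℕ-cancel-≤ fromℕ-mono-≤) (fromℕ (suc j) ℚ.≤? fromℕ m) (suc j ℕ.≤? m)

    -- The value of `O≤` occurs in the condition and in both branches; abstracting it replaces all
    -- three at once.
    go : ∀ o′ → o′ ≡ o →
      (if does (fromℕ (suc j) ℚ.≤? ½ ℚ.* fromℤ (E≤ (fromℤ (+ R ℤ.- + r ℤ.* o′)))) then o′ ℤ.+ + 2 else o′) ≡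
      (if j <ᵇ m then + suc (suc q ℕ.+ suc q) else o)
    go _ refl = trans
      (cong (λ y → if does (fromℕ (suc j) ℚ.≤? y) then o ℤ.+ + 2 else o) threshold)
      (cong₂ (λ b i → if b then i else o) below (cong (λ n → + n) (next q)))
      where
      next : ∀ q → suc (q ℕ.+ q) ℕ.+ 2 ≡ suc (suc q ℕ.+ suc q)
      next = solve-∀

  product-threshold : ∀ r m m′ X Y → m ℕ.+ m′ ≡ r → (f : Fin r → ℚ) →
    (∀ j → f j ≡ fromℕ (if toℕ j <ᵇ m then X else Y)) →
    product f ≡ fromℕ (X ℕ.^ m ℕ.* Y ℕ.^ m′)
  product-threshold zero    zero    zero     X Y eq   f f≡ = refl
  product-threshold (suc r) zero    (suc m′) X Y eq   f f≡ = begin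
    f Fin.zero ℚ.* product (f ∘ Fin.suc)           ≡⟨ cong₂ ℚ._*_ (f≡ Fin.zero)
        (product-threshold r 0 m′ X Y (ℕ.suc-injective eq) (f ∘ Fin.suc) (f≡ ∘ Fin.suc)) ⟩
    fromℕ Y ℚ.* fromℕ (1 ℕ.* Y ℕ.^ m′)             ≡⟨ fromℕ-* Y (1 ℕ.* Y ℕ.^ m′) ⟩
    fromℕ (Y ℕ.* (1 ℕ.* Y ℕ.^ m′))                 ≡⟨ cong fromℕ (regroup Y (Y ℕ.^ m′)) ⟩
    fromℕ (1 ℕ.* (Y ℕ.* Y ℕ.^ m′))                 ∎
    where
    open ≡-Reasoning
    regroup : ∀ y z → y ℕ.* (1 ℕ.* z) ≡ 1 ℕ.* (y ℕ.* z)
    regroup = solve-∀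
  product-threshold (suc r) (suc m) m′       X Y eq   f f≡ = begin
    f Fin.zero ℚ.* product (f ∘ Fin.suc)           ≡⟨ cong₂ ℚ._*_ (f≡ Fin.zero)
        (product-threshold r m m′ X Y (ℕ.suc-injective eq) (f ∘ Fin.suc) (f≡ ∘ Fin.suc)) ⟩
    fromℕ X ℚ.* fromℕ (X ℕ.^ m ℕ.* Y ℕ.^ m′)       ≡⟨ fromℕ-* X (X ℕ.^ m ℕ.* Y ℕ.^ m′) ⟩
    fromℕ (X ℕ.* (X ℕ.^ m ℕ.* Y ℕ.^ m′))           ≡⟨ cong fromℕ (ℕ.*-assoc X (X ℕ.^ m) (Y ℕ.^ m′)) ⟨
    fromℕ (X ℕ.* X ℕ.^ m ℕ.* Y ℕ.^ m′)             ∎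
    where open ≡-Reasoning

  binom-half : ∀ s r → binom (floor ((+ (s ℕ.+ s ℕ.+ r) ℤ.- + r) ℚ./ 2) ℤ.+ + r) r ≡ (s ℕ.+ r) C r
  binom-half s r = cong (λ i → binom (i ℤ.+ + r) r) (floor-half s r)

  *-congʳ : ∀ a x y → x ≡ y → a ℚ.* x ≡ a ℚ.* y
  *-congʳ a x .x refl = refl

  term : (M rmin K : ℕ) → ℤ → ℚ
  term M rmin K i = fromℕ M ℚ.* ((+ M ℚ./ 2) ℚ.* (fromℤ i ℚ.+ 1ℚ) ℚ.- fromℕ rmin ℚ.+ 1ℚ) ^ K

  module _ (r : ℕ) .{{nz : NonZero r}} (rmin rmax n M : ℕ) where

    bound-product : ℚ
    bound-product = product {r} (λ j → fromℕ M
      ℚ.* ((+ M ℚ./ 2) ℚ.* (fromℤ (σ r n {{nz}} (suc (toℕ j))) ℚ.+ 1ℚ) ℚ.- fromℕ rmin ℚ.+ 1ℚ) ^ (rmax ∸ 1))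

    bound-factors : ∀ b → binom (floor ((+ n ℤ.- + r) ℚ./ 2) ℤ.+ + r) r ≡ b →
      bound r rmin rmax n M {{nz}} ≡ fromℕ b ℚ.* bound-product
    bound-factors b refl = refl

    bound-value : ∀ b y → binom (floor ((+ n ℤ.- + r) ℚ./ 2) ℤ.+ + r) r ≡ b → bound-product ≡ fromℕ y →
      bound r rmin rmax n M {{nz}} ≡ fromℕ (b ℕ.* y)
    bound-value b y eq eq′ = begin
      bound r rmin rmax n M {{nz}}   ≡⟨ bound-factors b eq ⟩
      fromℕ b ℚ.* bound-product      ≡⟨ *-congʳ (fromℕ b) bound-product (fromℕ y) eq′ ⟩
      fromℕ b ℚ.* fromℕ y            ≡⟨ fromℕ-* b y ⟩
      fromℕ (b ℕ.* y)                ∎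
      where open ≡-Reasoning

    -- A negative floor pushes the upper index below `r`, so the bound is 0 whatever the product is.
    bound-few : n ℕ.< r → bound r rmin rmax n M {{nz}} ≡ fromℕ 0
    bound-few n<r = begin
      bound r rmin rmax n M {{nz}}   ≡⟨ bound-factors 0 (binom≡0 (floor-negative ((+ n ℤ.- + r) ℚ./ 2) x<0)) ⟩
      fromℕ 0 ℚ.* bound-product      ≡⟨ ℚ.*-zeroˡ bound-product ⟩
      fromℕ 0                        ∎
      where
      open ≡-Reasoning
      x<0 : (+ n ℤ.- + r) ℚ./ 2 ℚ.< 0ℚ
      x<0 = ℚ.≰⇒> λ 0≤x → ℕ.<⇒≱ n<r
        (ℤ.drop‿+≤+ (ℤ.0≤i-j⇒j≤i (fromℤ≤/⁻ (+ 0) (+ n ℤ.- + r) 1 0≤x)))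
      binom≡0 : ∃[ k ] floor ((+ n ℤ.- + r) ℚ./ 2) ≡ -[1+ k ] →
        binom (floor ((+ n ℤ.- + r) ℚ./ 2) ℤ.+ + r) r ≡ 0
      binom≡0 (k , eq) = trans (cong (λ i → binom (i ℤ.+ + r) r) eq) (binom-⊖-vanishes r k r ℕ.≤-refl)

  bound-alternating : ∀ r .{{nz : NonZero r}} rmin s → bound r rmin 1 (s ℕ.+ s ℕ.+ r) 1 {{nz}} ≡ fromℕ ((s ℕ.+ r) C r)
  bound-alternating r {{nz}} rmin s = trans
    (bound-value r {{nz}} rmin 1 (s ℕ.+ s ℕ.+ r) 1 ((s ℕ.+ r) C r) (1 ℕ.* 1 ℕ.^ r) (binom-half s r)
      -- The exponent rmax - 1 is 0, so each factor is 1 whatever the value of `σ`.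
      (product-threshold r 0 r 1 1 refl (λ _ → fromℕ 1 ℚ.* 1ℚ) (λ _ → refl)))
    (cong fromℕ (trans (cong (((s ℕ.+ r) C r) ℕ.*_) (trans (ℕ.*-identityˡ (1 ℕ.^ r)) (ℕ.^-zeroˡ r)))
      (ℕ.*-identityʳ ((s ℕ.+ r) C r))))

  bound-balanced : ∀ r .{{nz : NonZero r}} rmin rmax M n s q m m′ → m ℕ.< r → m ℕ.+ m′ ≡ r →
    s ≡ q ℕ.* r ℕ.+ m → n ≡ s ℕ.+ s ℕ.+ r →
    .{{_ : NonZero (factor M rmin q)}} .{{_ : NonZero (factor M rmin (suc q))}} →
    bound r rmin rmax n M {{nz}} ≡
    fromℕ (((s ℕ.+ r) C r) ℕ.* ((M ℕ.* factor M rmin (suc q) ℕ.^ (rmax ∸ 1)) ℕ.^ m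
                            ℕ.* (M ℕ.* factor M rmin q ℕ.^ (rmax ∸ 1)) ℕ.^ m′))
  bound-balanced r {{nz}} rmin rmax M n s q m m′ m<r m+m′≡r s≡ n≡ {{nzA}} {{nzB}} =
    bound-value r {{nz}} rmin rmax n M ((s ℕ.+ r) C r)
      ((M ℕ.* factor M rmin (suc q) ℕ.^ (rmax ∸ 1)) ℕ.^ m ℕ.* (M ℕ.* factor M rmin q ℕ.^ (rmax ∸ 1)) ℕ.^ m′)
      (trans (cong (λ n → binom (floor ((+ n ℤ.- + r) ℚ./ 2) ℤ.+ + r) r) n≡) (binom-half s r))
      (product-threshold r m m′ (M ℕ.* factor M rmin (suc q) ℕ.^ (rmax ∸ 1)) (M ℕ.* factor M rmin q ℕ.^ (rmax ∸ 1)) m+m′≡r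
        (λ j → fromℕ M
          ℚ.* ((+ M ℚ./ 2) ℚ.* (fromℤ (σ r n {{nz}} (suc (toℕ j))) ℚ.+ 1ℚ) ℚ.- fromℕ rmin ℚ.+ 1ℚ) ^ (rmax ∸ 1))
        term≡)
    where
    value : ∀ t .{{_ : NonZero (factor M rmin t)}} → term M rmin (rmax ∸ 1) (+ suc (t ℕ.+ t)) ≡ fromℕ (M ℕ.* factor M rmin t ℕ.^ (rmax ∸ 1))
    value t = begin
      term M rmin (rmax ∸ 1) (+ suc (t ℕ.+ t))
        ≡⟨ *-congʳ (fromℕ M) _ (fromℕ (factor M rmin t) ^ (rmax ∸ 1)) (cong (_^ (rmax ∸ 1)) (factor-fromℕ M rmin t)) ⟩
      fromℕ M ℚ.* fromℕ (factor M rmin t) ^ (rmax ∸ 1)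
        ≡⟨ *-congʳ (fromℕ M) (fromℕ (factor M rmin t) ^ (rmax ∸ 1)) (fromℕ (factor M rmin t ℕ.^ (rmax ∸ 1))) (fromℕ-^ (factor M rmin t) (rmax ∸ 1)) ⟩
      fromℕ M ℚ.* fromℕ (factor M rmin t ℕ.^ (rmax ∸ 1))
        ≡⟨ fromℕ-* M (factor M rmin t ℕ.^ (rmax ∸ 1)) ⟩
      fromℕ (M ℕ.* factor M rmin t ℕ.^ (rmax ∸ 1)) ∎
      where open ≡-Reasoning

    X = M ℕ.* factor M rmin (suc q) ℕ.^ (rmax ∸ 1)
    Y = M ℕ.* factor M rmin q ℕ.^ (rmax ∸ 1)

    choose : ∀ b → term M rmin (rmax ∸ 1) (if b then + suc (suc q ℕ.+ suc q) else + suc (q ℕ.+ q)) ≡ fromℕ (if b then X else Y)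
    choose true  = value (suc q) {{nzB}}
    choose false = value q {{nzA}}

    term≡ : ∀ (j : Fin r) → term M rmin (rmax ∸ 1) (σ r n {{nz}} (suc (toℕ j))) ≡ fromℕ (if toℕ j <ᵇ m then X else Y)
    term≡ j = trans
      (cong (term M rmin (rmax ∸ 1)) {σ r n {{nz}} (suc (toℕ j))}
        {if toℕ j <ᵇ m then + suc (suc q ℕ.+ suc q) else + suc (q ℕ.+ q)}
        (σ-balanced r {{nz}} n q m m<r (trans n≡ (cong (λ s → s ℕ.+ s ℕ.+ r) s≡)) (toℕ j)))
      (choose (toℕ j <ᵇ m))

-- From encoded words to the theorem

module Assembly where

  open Occurrences using (count; occurrences≡count)
  open Runs
  open Embeddings
  open Balance
  open RationalBound using (fromℕ-mono-≤)
  open BoundValue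
  open import Defs
  open import Data.List using (List; []; _∷_; length; map; replicate)
  open import Data.List.Extrema.Nat using (max; xs≤max; min≤xs; max≈v⁺)
  open import Data.List.NonEmpty using (List⁺; toList)
  open import Data.List.Relation.Unary.All as All using (All; []; _∷_)
  open import Data.List.Relation.Unary.All.Properties using (map⁻; map⁺)
  open import Data.List.Relation.Unary.Any using (here)
  open import Data.Nat as ℕ using (ℕ; zero; suc; _∸_; NonZero; ⌊_/2⌋)
  open import Data.Nat.Combinatorics using (_C_)
  import Data.Nat.DivMod as ℕ
  import Data.Nat.Properties as ℕ
  open import Data.Nat.Tactic.RingSolver using (solve-∀)
  open import Data.Product using (_,_; _×_; ∃-syntax)
  open import Data.Rational as ℚ using (ℚ; 0ℚ)
  import Data.Rational.Properties as ℚ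
  open import Data.Sum using (inj₁; inj₂)
  open import Relation.Binary.PropositionalEquality

  ≤-positivePart : ∀ c y N → y ≡ fromℕ N → c ℕ.≤ N → fromℕ c ℚ.≤ 0ℚ ℚ.⊔ y
  ≤-positivePart c _ N refl c≤N = ℚ.≤-trans (fromℕ-mono-≤ c≤N) (ℚ.p≤q⊔p 0ℚ (fromℕ N))

  0≤-positivePart : ∀ c y → c ≡ 0 → fromℕ c ℚ.≤ 0ℚ ℚ.⊔ y
  0≤-positivePart _ y refl = ℚ.p≤p⊔q 0ℚ y

  module _ (b : Letter) (ks ms : List ℕ) where

    count≤profiles : ∀ {M} s → ShortRuns {M} ms → length ms ≡ s ℕ.+ s ℕ.+ length ks →
      count (expand b ks) (expand b ms) ℕ.≤ profiles M ks s
    count≤profiles {M} s short eq = begin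
      count (expand b ks) (expand b ms)             ≤⟨ count≤embeddings ks b ms short ⟩
      embeddings M ks (length ms)                   ≡⟨ cong (embeddings M ks) eq ⟩
      embeddings M ks (s ℕ.+ s ℕ.+ length ks)       ≡⟨ embeddings-profiles M ks s ⟩
      profiles M ks s                               ∎
      where open ℕ.≤-Reasoning

    count-few : length ms ℕ.< length ks → count (expand b ks) (expand b ms) ≡ 0
    count-few lt = ℕ.n≤0⇒n≡0 (ℕ.≤-trans
      -- Any bound on the run lengths will do; an encoded `m` stands for length `suc m`.
      (count≤embeddings ks b ms (All.map (λ m≤ → ℕ.s≤s m≤) (xs≤max 0 ms)))
      (ℕ.≤-reflexive (embeddings-vanishes (suc (max 0 ms)) ks (length ms) lt)))

    module _ .{{nz : NonZero (length ks)}} where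

      private r = length ks

      count≤bound-balanced : ∀ rmin rmax M n s q m m′ →
        All (FitsBetween M rmin (rmax ∸ 1)) ks → ShortRuns {M} ms → length ms ≡ n →
        m ℕ.< r → m ℕ.+ m′ ≡ r → s ≡ q ℕ.* r ℕ.+ m → n ≡ s ℕ.+ s ℕ.+ r →
        fromℕ (count (expand b ks) (expand b ms)) ℚ.≤ 0ℚ ℚ.⊔ bound r rmin rmax n M {{nz}}
      count≤bound-balanced rmin rmax M n s q m m′ fits short len m<r m+m′≡r s≡ n≡ = by-factor (factor M rmin q) refl
        where
        count≤ : count (expand b ks) (expand b ms) ℕ.≤ profiles M ks s
        count≤ = count≤profiles s short (trans len n≡)

        s< : s ℕ.< r ℕ.* suc q
        s< = ℕ.≤-<-trans (ℕ.≤-reflexive s≡)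
          (ℕ.<-≤-trans (ℕ.+-monoʳ-< (q ℕ.* r) m<r) (ℕ.≤-reflexive (expansion q r)))
          where
          expansion : ∀ q r → q ℕ.* r ℕ.+ r ≡ r ℕ.* suc q
          expansion = solve-∀

        by-factor : ∀ x → factor M rmin q ≡ x →
          fromℕ (count (expand b ks) (expand b ms)) ℚ.≤ 0ℚ ℚ.⊔ bound r rmin rmax n M {{nz}}
        -- The rational base for σ = 2 q + 1 is at most 0 here, so the bound may be negative; the
        -- count is 0 because no profile survives.
        by-factor zero    eq = 0≤-positivePart (count (expand b ks) (expand b ms)) (bound r rmin rmax n M {{nz}})
          (ℕ.n≤0⇒n≡0 (ℕ.≤-trans count≤
            (ℕ.≤-reflexive (profiles-vanishes M rmin (rmax ∸ 1) q eq ks fits s s<))))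
        by-factor (suc x) eq = ≤-positivePart (count (expand b ks) (expand b ms)) (bound r rmin rmax n M {{nz}})
          (((s ℕ.+ r) C r) ℕ.* ((M ℕ.* factor M rmin (suc q) ℕ.^ (rmax ∸ 1)) ℕ.^ m
                            ℕ.* (M ℕ.* factor M rmin q ℕ.^ (rmax ∸ 1)) ℕ.^ m′))
          (bound-balanced r {{nz}} rmin rmax M n s q m m′ m<r m+m′≡r s≡ n≡ {{A≢0}} {{B≢0}})
          (ℕ.≤-trans count≤ (profiles-balanced M rmin (rmax ∸ 1) q {{A≢0}} ks fits s m m′ m+m′≡r s≡))
          where
          A≢0 : NonZero (factor M rmin q)
          A≢0 = subst NonZero (sym eq) _
          B≢0 : NonZero (factor M rmin (suc q))
          B≢0 = ℕ.>-nonZero (ℕ.<-≤-trans (ℕ.>-nonZero⁻¹ (factor M rmin q) {{A≢0}}) (factor-mono M rmin q))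

      count≤bound : ∀ rmin rmax M → All (FitsBetween M rmin (rmax ∸ 1)) ks → ShortRuns {M} ms →
        Matches r (length ms) →
        fromℕ (count (expand b ks) (expand b ms)) ℚ.≤ 0ℚ ℚ.⊔ bound r rmin rmax (length ms) M {{nz}}
      count≤bound rmin rmax M fits short (inj₂ few) =
        0≤-positivePart (count (expand b ks) (expand b ms)) (bound r rmin rmax (length ms) M {{nz}}) (count-few few)
      count≤bound rmin rmax M fits short (inj₁ (s , eq)) =
        count≤bound-balanced rmin rmax M (length ms) s (s ℕ./ r) (s ℕ.% r) (r ∸ s ℕ.% r) fits short refl (ℕ.m%n<n s r)
          (ℕ.m+[n∸m]≡n (ℕ.<⇒≤ (ℕ.m%n<n s r)))
          (trans (ℕ.m≡m%n+[m/n]*n s r) (ℕ.+-comm (s ℕ.% r) (s ℕ./ r ℕ.* r))) eq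

      -- `M` is constrained only for nonempty `ms`: the empty word has `maxRun` 0, and there both
      -- sides are 0.
      count≡bound-alternating : ∀ rmin rmax M → All (_≡ 0) ks → All (_≡ 0) ms → rmax ≡ 1 → (0 ℕ.< length ms → M ≡ 1) →
        Matches r (length ms) →
        fromℕ (count (expand b ks) (expand b ms)) ≡ bound r rmin rmax (length ms) M {{nz}}
      count≡bound-alternating rmin rmax M ks0 ms0 _    _     (inj₂ few) = trans
        (cong fromℕ (count-few few))
        (sym (bound-few r {{nz}} rmin rmax (length ms) M few))
      count≡bound-alternating rmin rmax M ks0 ms0 refl M≡1 (inj₁ (s , eq)) = trans
        (cong fromℕ (trans (cong₂ (λ ks ms → count (expand b ks) (expand b ms)) (zeros ks0) (zeros ms0))
          (trans (count-alternating b r (length ms)) (cong (_C r) half))))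
        (sym (value (length ms) M eq (M≡1 (ℕ.≤-trans (ℕ.>-nonZero⁻¹ r) (ℕ.≤-trans (ℕ.m≤n+m r (s ℕ.+ s)) (ℕ.≤-reflexive (sym eq)))))))
        where
        zeros : ∀ {ls : List ℕ} → All (_≡ 0) ls → ls ≡ replicate (length ls) 0
        zeros []           = refl
        zeros (refl ∷ ls0) = cong (0 ∷_) (zeros ls0)
        half : ⌊ length ms ℕ.+ r /2⌋ ≡ s ℕ.+ r
        half = trans (cong ⌊_/2⌋ (trans (cong (ℕ._+ r) eq) (regroup s r))) (sym (ℕ.n≡⌊n+n/2⌋ (s ℕ.+ r)))
          where
          regroup : ∀ s r → s ℕ.+ s ℕ.+ r ℕ.+ r ≡ s ℕ.+ r ℕ.+ (s ℕ.+ r)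
          regroup = solve-∀
        value : ∀ n M → n ≡ s ℕ.+ s ℕ.+ r → M ≡ 1 → bound r rmin 1 n M {{nz}} ≡ fromℕ ((s ℕ.+ r) C r)
        value _ _ refl refl = bound-alternating r {{nz}} rmin s

    -- `r` and its `NonZero` instance are variables here, so that the equation with `length ks` can
    -- be matched and the instance follows.
    count≤bound′ : ∀ c r .{{nz : NonZero r}} rmin rmax n M → r ≡ length ks → n ≡ length ms →
      c ≡ count (expand b ks) (expand b ms) →
      All (FitsBetween M rmin (rmax ∸ 1)) ks → ShortRuns {M} ms → Matches (length ks) (length ms) →
      fromℕ c ℚ.≤ 0ℚ ℚ.⊔ bound r rmin rmax n M {{nz}}
    count≤bound′ _ _ {{nz}} rmin rmax _ M refl refl refl = count≤bound {{nz}} rmin rmax M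

    count≡bound-alternating′ : ∀ c r .{{nz : NonZero r}} rmin rmax n M → r ≡ length ks → n ≡ length ms →
      c ≡ count (expand b ks) (expand b ms) →
      All (_≡ 0) ks → All (_≡ 0) ms → rmax ≡ 1 → (0 ℕ.< length ms → M ≡ 1) → Matches (length ks) (length ms) →
      fromℕ c ≡ bound r rmin rmax n M {{nz}}
    count≡bound-alternating′ _ _ {{nz}} rmin rmax _ M refl refl refl = count≡bound-alternating {{nz}} rmin rmax M

  maxRun-expand : ∀ b ls → maxRun (expand b ls) ≡ max 0 (map suc ls)
  maxRun-expand b ls = cong (max 0) (runLengths-expand b ls)

  maxRun-alternating : ∀ b {ls} → All (_≡ 0) ls → 0 ℕ.< length ls → maxRun (expand b ls) ≡ 1
  maxRun-alternating b {l ∷ ls} (refl ∷ ls0) _ = trans (maxRun-expand b (0 ∷ ls))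
    (max≈v⁺ {xs = 1 ∷ map suc ls} (here refl) (ℕ.≤-refl ∷ map⁺ (All.map (λ { refl → ℕ.≤-refl }) ls0)) ℕ.z≤n)

  shortRuns-expand : ∀ b ls → ShortRuns {maxRun (expand b ls)} ls
  shortRuns-expand b ls = map⁻ (subst (All (ℕ._≤ maxRun (expand b ls))) (runLengths-expand b ls)
    (xs≤max 0 (runLengths (expand b ls))))

  fits-expand : ∀ M b ls → All (FitsBetween M (minRun (expand b ls)) (maxRun (expand b ls) ∸ 1)) ls
  fits-expand M b ls = All.zip
    ( map⁻ (subst (All (minRun (expand b ls) ℕ.≤_)) (runLengths-expand b ls)
        (min≤xs (length (expand b ls)) (runLengths (expand b ls))))
    , All.map (ℕ.∸-monoˡ-≤ 1) (shortRuns-expand b ls))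

  module _ (p : List⁺ Letter) (w : Word) where

    Bounds : ℚ → Set
    Bounds y = fromℕ (occurrences (toList p) w) ℚ.≤ 0ℚ ℚ.⊔ y
      × (Alternating (toList p) → Alternating w → fromℕ (occurrences (toList p) w) ≡ y)

    unfoldedBound : ℚ
    unfoldedBound = bound (numRuns (toList p)) (minRun (toList p)) (maxRun (toList p))
      (numRuns (removeNBRs p w)) (maxRun (removeNBRs p w)) {{numRuns-nonZero p}}

    bounds-expand : ∀ b ks a ls → toList p ≡ expand b ks → w ≡ expand a ls → Bounds unfoldedBound
    bounds-expand b ks a ls p≡ refl = result (removeNBRs-expand p b ks p≡ a ls)
      where
      result : (∃[ ms ] removeNBRs p w ≡ expand b ms × count (toList p) w ≡ count (toList p) (expand b ms) ×
        Matches (length ks) (length ms) × (∀ {P : ℕ → Set} → All P ls → All P ms)) → Bounds unfoldedBound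
      result (ms , w′≡ , count≡ , matches , all) =
          count≤bound′ b ks ms (occurrences (toList p) w) (numRuns (toList p)) {{numRuns-nonZero p}}
            (minRun (toList p)) (maxRun (toList p)) (numRuns (removeNBRs p w)) (maxRun (removeNBRs p w))
            r≡ n≡ c≡
            (subst (λ v → All (FitsBetween (maxRun (removeNBRs p w)) (minRun v) (maxRun v ∸ 1)) ks) (sym p≡)
              (fits-expand (maxRun (removeNBRs p w)) b ks))
            (subst (λ v → ShortRuns {maxRun v} ms) (sym w′≡) (shortRuns-expand b ms))
            matches
        , λ p-alt w-alt →
          count≡bound-alternating′ b ks ms (occurrences (toList p) w) (numRuns (toList p)) {{numRuns-nonZero p}}
            (minRun (toList p)) (maxRun (toList p)) (numRuns (removeNBRs p w)) (maxRun (removeNBRs p w))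
            r≡ n≡ c≡ (zeros p-alt) (all (alternating-expand a ls w-alt))
            (trans (cong maxRun p≡) (maxRun-alternating b (zeros p-alt) (nonempty ks p≡)))
            (λ n>0 → trans (cong maxRun w′≡) (maxRun-alternating b (all (alternating-expand a ls w-alt)) n>0))
            matches
        where
        r≡ : numRuns (toList p) ≡ length ks
        r≡ = trans (cong numRuns p≡) (numRuns-expand b ks)
        n≡ : numRuns (removeNBRs p w) ≡ length ms
        n≡ = trans (cong numRuns w′≡) (numRuns-expand b ms)
        c≡ : occurrences (toList p) w ≡ count (expand b ks) (expand b ms)
        c≡ = trans (occurrences≡count (toList p) w) (trans count≡ (cong (λ v → count v (expand b ms)) p≡))
        zeros : Alternating (toList p) → All (_≡ 0) ks
        zeros p-alt = alternating-expand b ks (subst Alternating p≡ p-alt)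
        nonempty : ∀ ks → toList p ≡ expand b ks → 0 ℕ.< length ks
        nonempty (_ ∷ _) _ = ℕ.z<s

    bounds : Bounds unfoldedBound
    bounds = result (represent (toList p)) (represent w)
      where
      result : (∃[ b ] ∃[ ks ] toList p ≡ expand b ks) → (∃[ a ] ∃[ ls ] w ≡ expand a ls) → Bounds unfoldedBound
      result (b , ks , p≡) (a , ls , w≡) = bounds-expand b ks a ls p≡ w≡

    patternBound-unfolded : unfoldedBound ≡ patternBound p w
    patternBound-unfolded = refl

open import Defs
open import Data.List.NonEmpty using (List⁺; toList)
open import Data.Product using (_×_)
open import Data.Rational using (_≤_; _⊔_; 0ℚ)
open import Relation.Binary.PropositionalEquality using (_≡_; subst)

theorem1p8 : (p : List⁺ Letter) (w : Word) →
    fromℕ (occurrences (toList p) w) ≤ 0ℚ ⊔ patternBound p w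
    × (Alternating (toList p) → Alternating w →
    fromℕ (occurrences (toList p) w) ≡ patternBound p w)
theorem1p8 p w = subst (Assembly.Bounds p w) {Assembly.unfoldedBound p w} {patternBound p w}
  (Assembly.patternBound-unfolded p w) (Assembly.bounds p w)
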